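{- Assuming Gap-ETH, there exist constants $\delta,\rho>0$ such that for any positive integer $q\ge\rho$ and any $0<\gamma\le 1$, no algorithm can take a label cover instance $\Gamma$ with $|V|=q$ and distinguish between $\mathrm{MaxCov}(\Gamma)=|U|$ and $\mathrm{MaxCov}(\Gamma)<\gamma|U|$ in $O_{q,\gamma}(|\Gamma|^{\delta q})$ time. This holds even restricted to instances with $|\Sigma_U|\le(1/\gamma)^{O(1)}$.
   Context: Gap-ETH: there exist constants $\delta,\epsilon>0$ such that no (randomized) algorithm can, given a 3-SAT formula $\phi$ on $n$ variables and $m=O(n)$ clauses, correctly distinguish with probability at least $2/3$ in time $O(2^{\delta n})$ between the case that all $m$ clauses are simultaneously satisfiable and the case that every assignment satisfies fewer than $(1-\epsilon)m$ clauses. A label cover instance $\Gamma=(G=(U,V,E),\Sigma_U,\Sigma_V,\Pi)$ consists of a bipartite graph $G$ with sides $U,V$, finite alphabets $\Sigma_U,\Sigma_V$, and for each edge $uv$ a constraint $\Pi_{uv}\subseteq\Sigma_U\times\Sigma_V$. A labeling $(\sigma_U:U\to\Sigma_U,\sigma_V:V\to\Sigma_V)$ covers edge $uv$ if $(\sigma_U(u),\sigma_V(v))\in\Pi_{uv}$, and covers $u\in U$ if it covers every edge incident to $u$. $\mathrm{MaxCov}(\Gamma)$ is the maximum over labelings of the number of covered vertices of $U$. $|\Gamma|:=|\Sigma_U||\Sigma_V||U||V|$. $O_{q,\gamma}(\cdot)$ hides a multiplicative factor depending only on $q,\gamma$.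
   Formalization: The bound (1/γ)^{O(1)} on |Σ_U| is read as a·(1/γ)^c with absolute constants a and c, since without the factor a it forces |Σ_U| ≤ 1 at γ = 1, where the problem is solvable in polynomial time. -}

module Defs where

open import Data.Bool.Base using (Bool; true; false; T; not; _xor_; if_then_else_)
open import Data.Bool.Properties using (T?)
open import Data.Fin.Base using (Fin; toℕ; finToFun)
open import Data.Fin.Properties using (all?)
open import Data.Integer.Base using (+_; ∣_∣)
open import Data.List.Base using (List; []; _∷_; length; filter; map; foldr; tabulate; allFin; cartesianProductWith)
open import Data.List.Extrema.Nat using (max)
open import Data.Maybe.Base using (Maybe; just; nothing)
import Data.Maybe.Relation.Unary.All as Maybe
open import Data.Nat.Base using (ℕ; zero; suc; _+_; _*_; _^_; _≤_; NonZero; _≡ᵇ_)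
open import Data.Product.Base using (∃; ∃-syntax; _×_; _,_; proj₁; proj₂)
open import Data.Rational.Base as ℚ using (ℚ; 0ℚ; 1ℚ; ↥_; ↧ₙ_)
open import Data.Sum.Base using (_⊎_)
open import Data.Vec.Base as Vec using (Vec; []; _∷_)
open import Data.Vec.Relation.Unary.Any as Any using (Any)
open import Function.Bundles using (_⇔_)
open import Relation.Binary.PropositionalEquality using (_≡_)
open import Relation.Nullary.Decidable using (Dec)
open import Relation.Nullary.Negation using (¬_)

fromℕ : ℕ → ℚ
fromℕ n = + n ℚ./ 1

record ℝ : Set₁ where
  field
    lower upper     : ℚ → Set
    lower-inhabited : ∃ lower
    upper-inhabited : ∃ upper
    lower-rounded   : ∀ p → lower p ⇔ (∃[ r ] (p ℚ.< r × lower r))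
    upper-rounded   : ∀ r → upper r ⇔ (∃[ p ] (p ℚ.< r × upper p))
    disjoint        : ∀ p → ¬ (lower p × upper p)
    located         : ∀ {p r} → p ℚ.< r → lower p ⊎ upper r

open ℝ public using (lower; upper)

Positiveᴿ : ℝ → Set
Positiveᴿ γ = lower γ 0ℚ

AtMostOneᴿ : ℝ → Set
AtMostOneᴿ γ = ¬ lower γ 1ℚ

-- For m > 0, k < γ · m in ℝ exactly when k < r · m for some rational r < γ;
-- for m = 0 both sides are false (k is a natural number).
_<_·ᴿ_ : ℕ → ℝ → ℕ → Set
k < γ ·ᴿ m = ∃[ r ] (lower γ r × fromℕ k ℚ.< r ℚ.* fromℕ m)

-- s ≤ a · (1/γ)^c, for γ > 0: by continuity it suffices that s · rᶜ ≤ a for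
-- all rationals 0 < r < γ, and the denominator of r is cleared.
_≤_·[1/_]^_ : ℕ → ℕ → ℝ → ℕ → Set
s ≤ a ·[1/ γ ]^ c =
  ∀ r → 0ℚ ℚ.< r → lower γ r → s * ∣ ↥ r ∣ ^ c ≤ a * (↧ₙ r) ^ c

-- t ≤ C · N^(δ·k), for rational δ ≥ 0, raised to the power of the
-- denominator of δ.
_≤_·_^[_·_] : ℕ → ℕ → ℕ → ℚ → ℕ → Set
t ≤ C · N ^[ δ · k ] = t ^ ↧ₙ δ ≤ C ^ ↧ₙ δ * N ^ (∣ ↥ δ ∣ * k)

-- Randomized algorithms: Jones's WHILE language over binary trees, with coin
-- tossing.  Each step has unit cost: expressions occurring in a fixed program
-- have bounded size, and trees are shared by reference, so that `cons` does
-- not copy.  With this cost measure the language and multi-tape (probabilistic)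
-- Turing machines simulate each other with polynomial overhead in the running
-- time plus the input length.

infixr 5 _∙_

data Tree : Set where
  nil : Tree
  _∙_ : Tree → Tree → Tree

data Expr : Set where
  var  : ℕ → Expr
  nil  : Expr
  cons : Expr → Expr → Expr
  hd   : Expr → Expr
  tl   : Expr → Expr

infix  6 _≔_
infixr 5 _⨾_

data Program : Set where
  _≔_    : ℕ → Expr → Program
  toss   : ℕ → Program
  _⨾_    : Program → Program → Program
  branch : Expr → Program → Program → Program
  while  : Expr → Program → Program

Store : Set
Store = ℕ → Tree

⟦_⟧ : Expr → Store → Tree
⟦ var x ⟧ s = s x
⟦ nil ⟧ s = nil
⟦ cons e f ⟧ s = ⟦ e ⟧ s ∙ ⟦ f ⟧ s
⟦ hd e ⟧ s with ⟦ e ⟧ s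
... | nil   = nil
... | t ∙ _ = t
⟦ tl e ⟧ s with ⟦ e ⟧ s
... | nil   = nil
... | _ ∙ t = t

_[_↦_] : Store → ℕ → Tree → Store
(s [ x ↦ t ]) y = if y ≡ᵇ x then t else s y

isTrue : Tree → Bool
isTrue nil     = false
isTrue (_ ∙ _) = true

encodeBool : Bool → Tree
encodeBool false = nil
encodeBool true  = nil ∙ nil

-- The list is the stack of commands still to be executed.
Config : Set
Config = List Program × Store

-- Every step draws a fresh fair coin, which only `toss` looks at.
step : Bool → Config → Config
step b ([] , s)                = [] , s
step b ((x ≔ e) ∷ K , s)       = K , s [ x ↦ ⟦ e ⟧ s ]
step b (toss x ∷ K , s)        = K , s [ x ↦ encodeBool b ]
step b ((p ⨾ q) ∷ K , s)       = p ∷ q ∷ K , s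
step b (branch e p q ∷ K , s)  = (if isTrue (⟦ e ⟧ s) then p else q) ∷ K , s
step b (while e p ∷ K , s)     =
  (if isTrue (⟦ e ⟧ s) then p ∷ while e p ∷ K else K) , s

run : ∀ {t} → Vec Bool t → Config → Config
run []      c = c
run (b ∷ ω) c = run ω (step b c)

-- Input and output are in variable 0; all other variables start as nil.
start : Program → Tree → Config
start p x = p ∷ [] , ((λ _ → nil) [ 0 ↦ x ])

output : Config → Bool
output (_ , s) = isTrue (s 0)

HaltsWithin : Program → Tree → ℕ → Set
HaltsWithin p x t = ∀ (ω : Vec Bool t) → proj₁ (run ω (start p x)) ≡ []

countCoins : ∀ t → (Vec Bool t → Bool) → ℕ
countCoins zero    P = if P [] then 1 else 0
countCoins (suc t) P =
  countCoins t (λ ω → P (false ∷ ω)) + countCoins t (λ ω → P (true ∷ ω))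

-- Among the 2ᵗ equally likely coin sequences, at least a fraction 2/3 makes
-- the output equal to b.
AnswersWHP : Program → Tree → ℕ → Bool → Set
AnswersWHP p x t b =
  2 * 2 ^ t ≤ 3 * countCoins t (λ ω → not (output (run ω (start p x)) xor b))

record PromiseProblem : Set₁ where
  field
    Instance : Set
    encode   : Instance → Tree
    Input    : Instance → Set   -- the instances the algorithm is run on
    Yes No   : Instance → Set

-- Bound C x t expresses t ≤ C · f(x) for the time bound O(f) at hand.
DistinguishableIn : (P : PromiseProblem) →
                    (ℕ → PromiseProblem.Instance P → ℕ → Set) → Set
DistinguishableIn P Bound =
  ∃[ p ] ∃[ C ] ∀ x → Input x → ∃[ t ]
    ( Bound C x t
    × HaltsWithin p (encode x) t
    × (Yes x → AnswersWHP p (encode x) t true)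
    × (No x → AnswersWHP p (encode x) t false) )
  where open PromiseProblem P

-- Numbers are encoded in unary.  This is harmless here: all numbers to be
-- encoded are at most n, or at most |Γ|.
encodeℕ : ℕ → Tree
encodeℕ zero    = nil
encodeℕ (suc n) = nil ∙ encodeℕ n

encodeList : List Tree → Tree
encodeList = foldr _∙_ nil

encodeTable : ∀ {n} → (Fin n → Tree) → Tree
encodeTable f = encodeList (tabulate f)

-- (true , i) is the variable i, and (false , i) its negation.
Literal : ℕ → Set
Literal n = Bool × Fin n

-- Repeated literals are allowed, so a clause has one to three distinct ones.
Clause : ℕ → Set
Clause n = Vec (Literal n) 3

record Formula : Set where
  field
    vars    : ℕ
    clauses : List (Clause vars)

  size : ℕ
  size = length clauses

Assignment : ℕ → Set
Assignment n = Fin n → Bool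

TrueLiteral : ∀ {n} → Assignment n → Literal n → Set
TrueLiteral a (sign , i) = T (not (a i xor sign))

Satisfies : ∀ {n} → Assignment n → Clause n → Set
Satisfies a = Any (TrueLiteral a)

satisfies? : ∀ {n} (a : Assignment n) (c : Clause n) → Dec (Satisfies a c)
satisfies? a = Any.any? (λ l → T? (not (a (proj₂ l) xor proj₁ l)))

satisfiedCount : (φ : Formula) → Assignment (Formula.vars φ) → ℕ
satisfiedCount φ a = length (filter (satisfies? a) (Formula.clauses φ))

encodeLiteral : ∀ {n} → Literal n → Tree
encodeLiteral (sign , i) = encodeBool sign ∙ encodeℕ (toℕ i)

encodeFormula : Formula → Tree
encodeFormula φ = encodeℕ vars ∙
  encodeList (map (λ c → encodeList (Vec.toList (Vec.map encodeLiteral c))) clauses)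
  where open Formula φ

Gap3SAT : (ε : ℚ) (B : ℕ) → PromiseProblem
Gap3SAT ε B = record
  { Instance = Formula
  ; encode   = encodeFormula
  ; Input    = λ φ → size φ ≤ B * vars φ
  ; Yes      = λ φ → ∃[ a ] satisfiedCount φ a ≡ size φ
  ; No       = λ φ → ∀ a →
      fromℕ (satisfiedCount φ a) ℚ.< (1ℚ ℚ.- ε) ℚ.* fromℕ (size φ)
  }
  where open Formula

-- B is the constant in m = O(n).  Taking δ and ε rational loses nothing: the
-- assertion for some δ, ε implies it for all smaller positive ones.
GapETH : Set
GapETH = ∃[ δ ] ∃[ ε ] ∃[ B ]
  ( 0ℚ ℚ.< δ × 0ℚ ℚ.< ε
  × ¬ DistinguishableIn (Gap3SAT ε B)
        (λ C φ t → t ≤ C · 2 ^[ δ · Formula.vars φ ]) )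

-- The vertex sets and alphabets are Fin of the respective sizes.  They are
-- nonempty, so that |Γ| > 0 and the time bounds in terms of |Γ| are not void.
record LabelCover : Set where
  field
    #U #V #ΣU #ΣV : ℕ
    .{{U-nonempty}}  : NonZero #U
    .{{V-nonempty}}  : NonZero #V
    .{{ΣU-nonempty}} : NonZero #ΣU
    .{{ΣV-nonempty}} : NonZero #ΣV
    -- `nothing` if uv is not an edge, and `just Π_uv` if it is
    constraint : Fin #U → Fin #V → Maybe (Fin #ΣU → Fin #ΣV → Bool)

  totalSize : ℕ
  totalSize = #ΣU * #ΣV * #U * #V

  Labeling : Set
  Labeling = (Fin #U → Fin #ΣU) × (Fin #V → Fin #ΣV)

  -- If uv is an edge, then it is covered.
  CoversEdge : Labeling → Fin #U → Fin #V → Set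
  CoversEdge (σU , σV) u v = Maybe.All (λ Π → T (Π (σU u) (σV v))) (constraint u v)

  Covers : Labeling → Fin #U → Set
  Covers σ u = ∀ v → CoversEdge σ u v

  covers? : ∀ σ u → Dec (Covers σ u)
  covers? (σU , σV) u =
    all? (λ v → Maybe.dec (λ Π → T? (Π (σU u) (σV v))) (constraint u v))

  coveredCount : Labeling → ℕ
  coveredCount σ = length (filter (covers? σ) (allFin #U))

  -- finToFun enumerates all functions between finite sets.
  labelings : List Labeling
  labelings = cartesianProductWith (λ i j → finToFun i , finToFun j)
                (allFin (#ΣU ^ #U)) (allFin (#ΣV ^ #V))

  maxCov : ℕ
  maxCov = max 0 (map coveredCount labelings)

encodeConstraint : ∀ {a b} → Maybe (Fin a → Fin b → Bool) → Tree
encodeConstraint nothing  = nil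
encodeConstraint (just Π) =
  encodeTable (λ x → encodeTable (λ y → encodeBool (Π x y))) ∙ nil

-- The encoding has size O(|Γ|).
encodeLabelCover : LabelCover → Tree
encodeLabelCover Γ =
  encodeℕ #U ∙ encodeℕ #V ∙ encodeℕ #ΣU ∙ encodeℕ #ΣV ∙
  encodeTable (λ u → encodeTable (λ v → encodeConstraint (constraint u v)))
  where open LabelCover Γ

GapMaxCov : (γ : ℝ) (Input : LabelCover → Set) → PromiseProblem
GapMaxCov γ Input = record
  { Instance = LabelCover
  ; encode   = encodeLabelCover
  ; Input    = Input
  ; Yes      = λ Γ → maxCov Γ ≡ #U Γ
  ; No       = λ Γ → maxCov Γ < γ ·ᴿ #U Γ
  }
  where open LabelCover

{-# OPTIONS --safe #-}

-- A 3-SAT formula φ with m = O(n) clauses in n variables is turned into a label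
-- cover instance Γ: the variables are divided into q blocks of g ≈ n/q
-- variables, which are the vertices of V and are labelled by assignments; the
-- vertices of U are the k-tuples of clauses, labelled by the choice of a literal
-- of each clause that is claimed to be true.  A labeling of V is an assignment,
-- and if this satisfies s clauses, then at most sᵏ of the mᵏ vertices of U are
-- covered, with equality for a suitable labeling of U.  Hence the gap 1 - ε
-- becomes (1 - ε)ᵏ, and k = O(log (1/γ)) suffices for γ.  As |Γ| is 2ᵍ up to a
-- factor polynomial in n, an algorithm with running time |Γ|^(δq) for label cover
-- solves 3-SAT in time 2^(δn) up to a polynomial factor.  The reduction itself
-- runs in time |Γ|^O(1), with an exponent that depends neither on q nor on γ; for
-- large q this is at most 2^(δn) as well.
module Submission where

open import Data.Bool.Base using (Bool; true; false; T; not; _xor_; _∧_; if_then_else_)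
open import Data.Bool.Properties using (T-∧)
open import Data.Fin.Base using (Fin; zero; suc; toℕ; fromℕ<; inject≤; combine; remQuot; finToFun; funToFin)
import Data.Fin.Properties as Fin
open import Data.Fin.Properties using (combine-remQuot; toℕ-combine; toℕ-inject≤; toℕ<n; fromℕ<-toℕ; finToFun-funToFin)
open import Data.Integer.Base as ℤ using (+_; -[1+_]; ∣_∣)
import Data.Integer.Properties as ℤ
import Data.Integer.Tactic.RingSolver as ℤ
open import Data.List.Base using (List; []; _∷_; [_]; _ʳ++_; length; map; filter; concatMap; allFin; lookup)
open import Data.List.Extrema.Nat using (xs≤max; argmax-sel; max≤v⁺)
open import Data.List.Membership.Propositional using (_∈_; lose)
open import Data.List.Membership.Propositional.Properties
  using (∈-concatMap⁺; ∈-map⁺; ∈-map⁻; ∈-cartesianProductWith⁺; ∈-allFin)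
open import Data.List.Properties
  using (length-map; length-++; length-filter; length-tabulate; length-ʳ++; filter-++; map-id; map-++;
         map-tabulate; tabulate-lookup; ++-ʳ++; ʳ++-ʳ++; ++-identityʳ; concatMap-pure)
import Data.List.Relation.Unary.All as Allˡ
import Data.List.Relation.Unary.All.Properties as Allˡ
import Data.List.Relation.Unary.Any as Anyˡ
import Data.List.Relation.Unary.Any.Properties as Anyˡ
open import Data.Maybe.Base using (just)
import Data.Maybe.Relation.Unary.All as Maybe
open import Data.Nat.Base
open import Data.Nat.Coprimality using (1-coprimeTo)
open import Data.Nat.DivMod using (_/_; m≡m%n+[m/n]*n; m%n<n; m/n*n≤m)
open import Data.Nat.Properties
open import Data.Nat.Tactic.RingSolver using (solve-∀)
open import Data.Product.Base using (∃-syntax; _×_; _,_; proj₁; proj₂)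
open import Data.Rational.Base as ℚ using (ℚ; mkℚ; 0ℚ; 1ℚ; ↥_; ↧ₙ_; toℚᵘ)
import Data.Rational.Properties as ℚ
open import Data.Rational.Unnormalised.Base as ℚᵘ using (mkℚᵘ)
import Data.Rational.Unnormalised.Properties as ℚᵘ
open import Data.Sum.Base using (_⊎_; inj₁; inj₂)
open import Data.Vec.Base as Vec using (Vec; []; _∷_)
import Data.Vec.Properties as Vec
open import Data.Vec.Relation.Unary.All as All using (All; []; _∷_)
import Data.Vec.Relation.Unary.All.Properties as All
open import Data.Vec.Relation.Unary.Any as Any using (Any; here; there)
import Data.Vec.Relation.Unary.Any.Properties as Any
open import Function.Base using (_∘_; id)
open import Function.Bundles using (Equivalence)
open import Relation.Binary.PropositionalEquality hiding (J; [_])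
open import Relation.Nullary.Decidable using (yes; no; does)
open import Relation.Nullary.Negation using (¬_; contradiction)
open import Relation.Unary using (Decidable)
open import Defs

-- Execution of programs

-- The exponent of the reduction is independent of q and γ because both are fixed before the program
-- is chosen: they enter it only through quoted constants, and an assignment costs one step whatever
-- its expression. The reduction is written in a small language whose only loops are folds over
-- lists. Its time is a constant times X^6, where 6 is the nesting of the folds and X, which is 2ᵍ
-- times a polynomial in n, bounds the lists folded over.
--
-- The budget: let b be the denominator of δ, so that δ ≥ 1/b. Label cover is assumed to be solved
-- in time |Γ|^(q/(2b)), which is 2^(n/(2b)) up to a polynomial in n, and q ≥ 12 · b gives the same
-- for X^6. The other half of the exponent n/b absorbs the polynomials. Times are compared through
-- their powers with exponent 2 · b, so that only natural exponents occur.
--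
-- A Dedekind real γ cannot be compared with a given rational. Locatedness still yields an l with
-- 2^-(l+2) < γ ≤ 2^-l; the lower bound serves the gap, the upper one the size of the alphabet.

⟦⟧-cong : ∀ e {s s′ : Store} → s ≗ s′ → ⟦ e ⟧ s ≡ ⟦ e ⟧ s′
⟦⟧-cong (var x) s≗s′ = s≗s′ x
⟦⟧-cong nil s≗s′ = refl
⟦⟧-cong (cons e f) s≗s′ = cong₂ _∙_ (⟦⟧-cong e s≗s′) (⟦⟧-cong f s≗s′)
⟦⟧-cong (hd e) s≗s′ rewrite ⟦⟧-cong e s≗s′ = refl
⟦⟧-cong (tl e) s≗s′ rewrite ⟦⟧-cong e s≗s′ = refl

update-cong : ∀ {s s′ : Store} x {t t′} → s ≗ s′ → t ≡ t′ → s [ x ↦ t ] ≗ s′ [ x ↦ t′ ]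
update-cong x s≗s′ refl y with y ≡ᵇ x
... | true  = refl
... | false = s≗s′ y

infix 4 _≈ᶜ_
-- Stores are functions, and without function extensionality the store left by the reduction equals
-- the initial store of the next program only pointwise.
_≈ᶜ_ : Config → Config → Set
(K , s) ≈ᶜ (K′ , s′) = K ≡ K′ × s ≗ s′

step-cong : ∀ b {c c′} → c ≈ᶜ c′ → step b c ≈ᶜ step b c′
step-cong b {[] , s} (refl , s≗s′) = refl , s≗s′
step-cong b {(x ≔ e) ∷ K , s} (refl , s≗s′) = refl , update-cong x s≗s′ (⟦⟧-cong e s≗s′)
step-cong b {toss x ∷ K , s} (refl , s≗s′) = refl , update-cong x s≗s′ refl
step-cong b {(p ⨾ q) ∷ K , s} (refl , s≗s′) = refl , s≗s′
step-cong b {branch e p q ∷ K , s} (refl , s≗s′) rewrite ⟦⟧-cong e s≗s′ = refl , s≗s′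
step-cong b {while e p ∷ K , s} (refl , s≗s′) rewrite ⟦⟧-cong e s≗s′ = refl , s≗s′

run-cong : ∀ {t} (ω : Vec Bool t) {c c′} → c ≈ᶜ c′ → run ω c ≈ᶜ run ω c′
run-cong []      c≈c′ = c≈c′
run-cong (b ∷ ω) c≈c′ = run-cong ω (step-cong b c≈c′)

output-cong : ∀ {c c′} → c ≈ᶜ c′ → output c ≡ output c′
output-cong (_ , s≗s′) = cong isTrue (s≗s′ 0)

infix 4 _⟶⟨_⟩_
-- Both coins must lead to the same configuration, so the coins drawn in these steps have no
-- influence on the rest of the run.
data _⟶⟨_⟩_ : Config → ℕ → Config → Set where
  done : ∀ {c} → c ⟶⟨ 0 ⟩ c
  next : ∀ {c c′ c″ n} → (∀ b → step b c ≡ c′) → c′ ⟶⟨ n ⟩ c″ → c ⟶⟨ suc n ⟩ c″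

⟶-trans : ∀ {c c′ c″ m n} → c ⟶⟨ m ⟩ c′ → c′ ⟶⟨ n ⟩ c″ → c ⟶⟨ m + n ⟩ c″
⟶-trans done        r = r
⟶-trans (next eq q) r = next eq (⟶-trans q r)

run-⟶ : ∀ {c c′ n t} → c ⟶⟨ n ⟩ c′ → (ω : Vec Bool (n + t)) → run ω c ≡ run (Vec.drop n ω) c′
run-⟶ done ω = refl
run-⟶ (next eq r) (b ∷ ω) = trans (cong (run ω) (eq b)) (run-⟶ r ω)

countCoins-cong : ∀ t {P Q : Vec Bool t → Bool} → P ≗ Q → countCoins t P ≡ countCoins t Q
countCoins-cong zero P≗Q rewrite P≗Q [] = refl
countCoins-cong (suc t) P≗Q =
  cong₂ _+_ (countCoins-cong t (λ ω → P≗Q (false ∷ ω))) (countCoins-cong t (λ ω → P≗Q (true ∷ ω)))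

countCoins-drop : ∀ n {t} (P : Vec Bool t → Bool) →
                  countCoins (n + t) (λ ω → P (Vec.drop n ω)) ≡ 2 ^ n * countCoins t P
countCoins-drop zero P = sym (+-identityʳ _)
countCoins-drop (suc n) {t} P rewrite countCoins-drop n P = lemma (2 ^ n) (countCoins t P)
  where lemma : ∀ a b → a * b + a * b ≡ (a + (a + 0)) * b
        lemma = solve-∀

only : Tree → Store
only ρ = (λ _ → nil) [ 0 ↦ ρ ]

-- Deterministic computations on stores in which only variable 0 is in use.
infix 4 _⟹⟨_⟩_
_⟹⟨_⟩_ : List Program × Tree → ℕ → List Program × Tree → Set
(K , ρ) ⟹⟨ n ⟩ (K′ , ρ′) =
  ∀ {s} → s ≗ only ρ → ∃[ s′ ] (s′ ≗ only ρ′ × (K , s) ⟶⟨ n ⟩ (K′ , s′))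

infixr 4 _▷_
_▷_ : ∀ {c c′ c″ m n} → c ⟹⟨ m ⟩ c′ → c′ ⟹⟨ n ⟩ c″ → c ⟹⟨ m + n ⟩ c″
(f ▷ g) eq with f eq
... | _ , eq′ , r with g eq′
... | _ , eq″ , r′ = _ , eq″ , ⟶-trans r r′

assign : ∀ {K ρ} e → ((0 ≔ e) ∷ K , ρ) ⟹⟨ 1 ⟩ (K , ⟦ e ⟧ (only ρ))
assign e eq =
  _ , (λ { zero → ⟦⟧-cong e eq ; (suc x) → eq (suc x) }) , next (λ _ → refl) done

unfold : ∀ {K p q ρ} → ((p ⨾ q) ∷ K , ρ) ⟹⟨ 1 ⟩ (p ∷ q ∷ K , ρ)
unfold eq = _ , eq , next (λ _ → refl) done

branch-step : ∀ {K ρ e p q v} → isTrue (⟦ e ⟧ (only ρ)) ≡ v →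
              (branch e p q ∷ K , ρ) ⟹⟨ 1 ⟩ ((if v then p else q) ∷ K , ρ)
branch-step {e = e} refl eq =
  _ , eq , next (λ _ → cong (λ t → (if isTrue t then _ else _) ∷ _ , _) (⟦⟧-cong e eq)) done

while-step : ∀ {K ρ e p v} → isTrue (⟦ e ⟧ (only ρ)) ≡ v →
             (while e p ∷ K , ρ) ⟹⟨ 1 ⟩ ((if v then p ∷ while e p ∷ K else K) , ρ)
while-step {e = e} refl eq =
  _ , eq , next (λ _ → cong (λ t → (if isTrue t then _ else _) , _) (⟦⟧-cong e eq)) done

-- A functional language whose environment is a tree, read as a list of values:
-- variables are de Bruijn indices, and the body of `fold` is evaluated with the
-- remaining list and the accumulator on top of the environment.
data Code : Set where
  ret  : Expr → Code
  let′ : Code → Code → Code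
  ifc  : Expr → Code → Code → Code
  fold : Expr → Expr → Code → Code

-- The type makes an environment a store, so that `Code` shares the expressions and the evaluation
-- `⟦_⟧` of programs.
nth : Tree → Store
nth nil     _       = nil
nth (t ∙ _) zero    = t
nth (_ ∙ ρ) (suc i) = nth ρ i

-- The derivations are parametrised by a bound X on the lengths of the lists
-- that are folded over, which bounds the running time polynomially.
module Evaluation (X : ℕ) where

  infix 4 _⊢_⇓_
  data _⊢_⇓_ (ρ : Tree) : Code → Tree → Set
  data Loop (ρ : Tree) (b : Code) : ℕ → Tree → Tree → Tree → Set

  data _⊢_⇓_ ρ where
    ret  : ∀ {e t} → ⟦ e ⟧ (nth ρ) ≡ t → ρ ⊢ ret e ⇓ t
    let′ : ∀ {c d x t} → ρ ⊢ c ⇓ x → x ∙ ρ ⊢ d ⇓ t → ρ ⊢ let′ c d ⇓ t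
    ifc  : ∀ {e c d t} v → isTrue (⟦ e ⟧ (nth ρ)) ≡ v → ρ ⊢ (if v then c else d) ⇓ t →
           ρ ⊢ ifc e c d ⇓ t
    fold : ∀ {e i b l a n t} → ⟦ e ⟧ (nth ρ) ≡ l → ⟦ i ⟧ (nth ρ) ≡ a →
           Loop ρ b n l a t → n ≤ X → ρ ⊢ fold e i b ⇓ t

  data Loop ρ b where
    done : ∀ {a} → Loop ρ b 0 nil a a
    next : ∀ {n h l a a′ t} → (h ∙ l) ∙ a ∙ ρ ⊢ b ⇓ a′ → Loop ρ b n l a′ t →
           Loop ρ b (suc n) (h ∙ l) a t

private
  nthᴱ : ℕ → Expr → Expr
  nthᴱ zero    e = hd e
  nthᴱ (suc i) e = nthᴱ i (tl e)

embed : Expr → Expr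
embed (var i)    = nthᴱ i (var 0)
embed nil        = nil
embed (cons e f) = cons (embed e) (embed f)
embed (hd e)     = hd (embed e)
embed (tl e)     = tl (embed e)

⟦embed⟧ : ∀ e ρ → ⟦ embed e ⟧ (only ρ) ≡ ⟦ e ⟧ (nth ρ)
⟦embed⟧ (var i) ρ = ⟦nthᴱ⟧ i (var 0) ρ refl
  where
  ⟦nthᴱ⟧ : ∀ i e t → ⟦ e ⟧ (only ρ) ≡ t → ⟦ nthᴱ i e ⟧ (only ρ) ≡ nth t i
  ⟦nthᴱ⟧ zero    e nil     eq rewrite eq = refl
  ⟦nthᴱ⟧ zero    e (t ∙ u) eq rewrite eq = refl
  ⟦nthᴱ⟧ (suc i) e nil     eq = ⟦nthᴱ⟧ i (tl e) nil lemma
    where lemma : ⟦ tl e ⟧ (only ρ) ≡ nil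
          lemma rewrite eq = refl
  ⟦nthᴱ⟧ (suc i) e (t ∙ u) eq = ⟦nthᴱ⟧ i (tl e) u lemma
    where lemma : ⟦ tl e ⟧ (only ρ) ≡ u
          lemma rewrite eq = refl
⟦embed⟧ nil ρ = refl
⟦embed⟧ (cons e f) ρ = cong₂ _∙_ (⟦embed⟧ e ρ) (⟦embed⟧ f ρ)
⟦embed⟧ (hd e) ρ rewrite ⟦embed⟧ e ρ = refl
⟦embed⟧ (tl e) ρ rewrite ⟦embed⟧ e ρ = refl

-- After `p`, variable 0 holds `a′ ∙ (h ∙ l) ∙ a ∙ ρ`; the assignment turns this into `l ∙ a′ ∙ ρ`
-- for the next iteration.
loopBody : Program → Program
loopBody p = p ⨾ (0 ≔ cons (tl (hd (tl (var 0)))) (cons (hd (var 0)) (tl (tl (tl (var 0))))))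

-- Pushes the value of the code onto the environment in variable 0.
compile : Code → Program
compile (ret e)      = 0 ≔ cons (embed e) (var 0)
compile (let′ c d)   = compile c ⨾ compile d ⨾ (0 ≔ cons (hd (var 0)) (tl (tl (var 0))))
compile (ifc e c d)  = branch (embed e) (compile c) (compile d)
compile (fold e i b) =
  (0 ≔ cons (embed e) (cons (embed i) (var 0))) ⨾
  while (hd (var 0)) (loopBody (compile b)) ⨾
  (0 ≔ tl (var 0))

-- A `fold` iterates at most X times, so the nesting of folds is the exponent of X in the running
-- time.
depth : Code → ℕ
depth (ret e)      = 0
depth (let′ c d)   = depth c ⊔ depth d
depth (ifc e c d)  = depth c ⊔ depth d
depth (fold e i b) = suc (depth b)

-- The constants count administrative steps: in `let′` two for sequencing and one assignment, in
-- `fold` three per iteration and five once. Expressions do not contribute, so quoted constants of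
-- any size change neither `weight` nor `depth`.
weight : Code → ℕ
weight (ret e)      = 1
weight (let′ c d)   = weight c + weight d + 3
weight (ifc e c d)  = weight c + weight d + 1
weight (fold e i b) = weight b + 8

module Compilation (X : ℕ) .{{_ : NonZero X}} where
  open Evaluation X

  bound : Code → ℕ
  bound c = weight c * X ^ depth c

  ≤bound : ∀ w w′ {d d′} → w ≤ w′ → d ≤ d′ → w * X ^ d ≤ w′ * X ^ d′
  ≤bound w w′ w≤w′ d≤d′ = *-mono-≤ w≤w′ (^-monoʳ-≤ X d≤d′)

  n≤n*X^ : ∀ n d → n ≤ n * X ^ d
  n≤n*X^ n d = m≤m*n n (X ^ d) {{m^n≢0 X d}}

  embed-assign : ∀ {K ρ t} e → ⟦ e ⟧ (nth ρ) ≡ t →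
                 (compile (ret e) ∷ K , ρ) ⟹⟨ 1 ⟩ (K , t ∙ ρ)
  embed-assign {K} {ρ} e refl =
    subst (λ t → _ ⟹⟨ 1 ⟩ (K , t ∙ ρ)) (⟦embed⟧ e ρ) (assign _)

  compile-correct : ∀ {ρ c t} → ρ ⊢ c ⇓ t →
    ∃[ n ] (n ≤ bound c × (∀ {K} → (compile c ∷ K , ρ) ⟹⟨ n ⟩ (K , t ∙ ρ)))
  loop-correct : ∀ {ρ b n l a t} → Loop ρ b n l a t →
    ∃[ m ] (m ≤ n * (bound b + 3) + 1 ×
      (∀ {K} → (while (hd (var 0)) (loopBody (compile b)) ∷ K , l ∙ a ∙ ρ) ⟹⟨ m ⟩ (K , nil ∙ t ∙ ρ)))

  compile-correct {c = ret e} (ret eq) = 1 , ≤-refl , embed-assign e eq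
  compile-correct {c = let′ c d} (let′ Dc Dd)
    with m , m≤ , rc ← compile-correct Dc
       | n , n≤ , rd ← compile-correct Dd =
    _ , le , (unfold ▷ rc ▷ unfold ▷ rd ▷ assign _)
    where
    open ≤-Reasoning
    D = depth c ⊔ depth d
    le : suc (m + suc (n + 1)) ≤ bound (let′ c d)
    le = begin
      suc (m + suc (n + 1))                     ≡⟨ lemma m n ⟩
      m + n + 3                                 ≤⟨ +-mono-≤ (+-mono-≤
        (≤-trans m≤ (≤bound (weight c) (weight c) ≤-refl (m≤m⊔n (depth c) (depth d))))
        (≤-trans n≤ (≤bound (weight d) (weight d) ≤-refl (m≤n⊔m (depth c) (depth d)))))
        (n≤n*X^ 3 D) ⟩
      weight c * X ^ D + weight d * X ^ D + 3 * X ^ D ≡⟨ lemma′ (weight c) (weight d) 3 (X ^ D) ⟩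
      (weight c + weight d + 3) * X ^ D         ∎
      where
      lemma : ∀ m n → suc (m + suc (n + 1)) ≡ m + n + 3
      lemma = solve-∀
      lemma′ : ∀ a b c x → a * x + b * x + c * x ≡ (a + b + c) * x
      lemma′ = solve-∀
  compile-correct {c = ifc e c d} (ifc true eq Dc)
    with m , m≤ , rc ← compile-correct Dc =
    _ , le , (branch-step (trans (cong isTrue (⟦embed⟧ e _)) eq) ▷ rc)
    where
    open ≤-Reasoning
    le : suc m ≤ bound (ifc e c d)
    le = begin
      suc m                        ≡⟨ +-comm 1 m ⟩
      m + 1                        ≤⟨ +-mono-≤ m≤ (n≤n*X^ 1 (depth c)) ⟩
      bound c + 1 * X ^ depth c    ≡⟨ *-distribʳ-+ (X ^ depth c) (weight c) 1 ⟨
      (weight c + 1) * X ^ depth c ≤⟨ ≤bound (weight c + 1) (weight c + weight d + 1) (+-monoˡ-≤ 1 (m≤m+n (weight c) (weight d))) (m≤m⊔n (depth c) (depth d)) ⟩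
      bound (ifc e c d)            ∎
  compile-correct {c = ifc e c d} (ifc false eq Dd)
    with m , m≤ , rd ← compile-correct Dd =
    _ , le , (branch-step (trans (cong isTrue (⟦embed⟧ e _)) eq) ▷ rd)
    where
    open ≤-Reasoning
    le : suc m ≤ bound (ifc e c d)
    le = begin
      suc m                        ≡⟨ +-comm 1 m ⟩
      m + 1                        ≤⟨ +-mono-≤ m≤ (n≤n*X^ 1 (depth d)) ⟩
      bound d + 1 * X ^ depth d    ≡⟨ *-distribʳ-+ (X ^ depth d) (weight d) 1 ⟨
      (weight d + 1) * X ^ depth d ≤⟨ ≤bound (weight d + 1) (weight c + weight d + 1) (+-monoˡ-≤ 1 (m≤n+m (weight d) (weight c))) (m≤n⊔m (depth c) (depth d)) ⟩
      bound (ifc e c d)            ∎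
  compile-correct {ρ} {fold e i b} {t} (fold {l = l} {a} {n} refl refl L n≤X)
    with m , m≤ , rl ← loop-correct L =
    _ , le , (unfold ▷ init ▷ unfold ▷ rl ▷ assign _)
    where
    open ≤-Reasoning
    init : ∀ {K} → ((0 ≔ cons (embed e) (cons (embed i) (var 0))) ∷ K , ρ) ⟹⟨ 1 ⟩ (K , l ∙ a ∙ ρ)
    init {K} = subst₂ (λ l a → _ ⟹⟨ 1 ⟩ (K , l ∙ a ∙ ρ)) (⟦embed⟧ e ρ) (⟦embed⟧ i ρ) (assign _)
    w = weight b
    Y = X ^ depth b
    le : suc (suc (suc (m + 1))) ≤ bound (fold e i b)
    le = begin
      suc (suc (suc (m + 1)))        ≡⟨ +-comm 3 (m + 1) ⟩
      m + 1 + 3                      ≤⟨ +-monoˡ-≤ 3 (+-monoˡ-≤ 1 m≤) ⟩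
      n * (w * Y + 3) + 1 + 1 + 3    ≡⟨ lemma (n * (w * Y + 3)) ⟩
      n * (w * Y + 3) + 5            ≤⟨ +-mono-≤ (*-mono-≤ n≤X (+-monoʳ-≤ (w * Y) (n≤n*X^ 3 (depth b)))) (n≤n*X^ 5 (suc (depth b))) ⟩
      X * (w * Y + 3 * Y) + 5 * (X * Y) ≡⟨ lemma′ X w Y ⟩
      (w + 8) * (X * Y)              ∎
      where
      lemma : ∀ m → m + 1 + 1 + 3 ≡ m + 5
      lemma = solve-∀
      lemma′ : ∀ x w y → x * (w * y + 3 * y) + 5 * (x * y) ≡ (w + 8) * (x * y)
      lemma′ = solve-∀

  loop-correct done = 1 , ≤-refl , while-step refl
  loop-correct {b = b} {suc n} (next {a′ = a′} D L)
    with m , m≤ , rb ← compile-correct D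
       | k , k≤ , rl ← loop-correct L =
    _ , le , (while-step refl ▷ unfold ▷ rb ▷ assign _ ▷ rl)
    where
    open ≤-Reasoning
    le : suc (suc (m + suc k)) ≤ suc n * (bound b + 3) + 1
    le = begin
      suc (suc (m + suc k))                        ≡⟨ lemma m k ⟩
      (m + 3) + k                                  ≤⟨ +-mono-≤ (+-monoˡ-≤ 3 m≤) k≤ ⟩
      bound b + 3 + (n * (bound b + 3) + 1)        ≡⟨ +-assoc (bound b + 3) (n * (bound b + 3)) 1 ⟨
      suc n * (bound b + 3) + 1                    ∎
      where
      lemma : ∀ m k → suc (suc (m + suc k)) ≡ (m + 3) + k
      lemma = solve-∀

-- The label cover instance

tuples : ∀ {A : Set} → List A → ∀ k → List (Vec A k)
tuples cs zero    = [] ∷ []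
tuples cs (suc k) = concatMap (λ c → map (c ∷_) (tuples cs k)) cs

length-tuples : ∀ {A : Set} (cs : List A) k → length (tuples cs k) ≡ length cs ^ k
length-tuples cs zero    = refl
length-tuples cs (suc k) = go cs
  where
  go : ∀ ds → length (concatMap (λ c → map (c ∷_) (tuples cs k)) ds) ≡ length ds * length cs ^ k
  go []       = refl
  go (d ∷ ds) = trans (length-++ (map (d ∷_) (tuples cs k)))
    (cong₂ _+_ (trans (length-map (d ∷_) (tuples cs k)) (length-tuples cs k)) (go ds))

∈-tuples : ∀ {A : Set} {cs : List A} {k} {v : Vec A k} → All (_∈ cs) v → v ∈ tuples cs k
∈-tuples [] = Anyˡ.here refl
∈-tuples {v = c ∷ v} (c∈cs ∷ v∈) =
  ∈-concatMap⁺ (λ c → map (c ∷_) _) (lose c∈cs (∈-map⁺ (c ∷_) (∈-tuples v∈)))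

module _ {A : Set} {P : A → Set} (P? : Decidable P) where

  private
    count-map : ∀ {k} c (us : List (Vec A k)) →
                length (filter (All.all? P?) (map (c ∷_) us)) ≡
                (if does (P? c) then length (filter (All.all? P?) us) else 0)
    count-map c [] with P? c
    ... | yes _ = refl
    ... | no _  = refl
    count-map c (u ∷ us) with P? c | count-map c us
    ... | no _  | ih = ih
    ... | yes _ | ih with All.all? P? u
    ...   | yes _ = cong suc ih
    ...   | no _  = ih

  count-tuples : ∀ cs k → length (filter (All.all? P?) (tuples cs k)) ≡ length (filter P? cs) ^ k
  count-tuples cs zero    = refl
  count-tuples cs (suc k) = go cs
    where
    go : ∀ ds → length (filter (All.all? P?) (concatMap (λ c → map (c ∷_) (tuples cs k)) ds)) ≡
                length (filter P? ds) * length (filter P? cs) ^ k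
    go [] = refl
    go (d ∷ ds)
      rewrite filter-++ (All.all? P?) (map (d ∷_) (tuples cs k)) (concatMap (λ c → map (c ∷_) (tuples cs k)) ds)
            | length-++ (filter (All.all? P?) (map (d ∷_) (tuples cs k)))
                {filter (All.all? P?) (concatMap (λ c → map (c ∷_) (tuples cs k)) ds)}
            | count-map d (tuples cs k) | go ds | count-tuples cs k
      with P? d
    ... | yes _ = refl
    ... | no _  = refl

module _ {A B : Set} {P : A → Set} {Q : B → Set} (P? : Decidable P) (Q? : Decidable Q) (f : A → B) where

  count-map-≤ : (∀ {x} → P x → Q (f x)) → ∀ xs → length (filter P? xs) ≤ length (filter Q? (map f xs))
  count-map-≤ P⇒Q [] = z≤n
  count-map-≤ P⇒Q (x ∷ xs) with P? x | Q? (f x) | count-map-≤ P⇒Q xs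
  ... | yes _  | yes _ | ih = s≤s ih
  ... | yes px | no ¬q | _  = contradiction (P⇒Q px) ¬q
  ... | no _   | yes _ | ih = m≤n⇒m≤1+n ih
  ... | no _   | no _  | ih = ih

  count-map-≥ : (∀ {x} → Q (f x) → P x) → ∀ xs → length (filter Q? (map f xs)) ≤ length (filter P? xs)
  count-map-≥ Q⇒P [] = z≤n
  count-map-≥ Q⇒P (x ∷ xs) with Q? (f x) | P? x | count-map-≥ Q⇒P xs
  ... | yes _  | yes _ | ih = s≤s ih
  ... | yes qx | no ¬p | _  = contradiction (Q⇒P qx) ¬p
  ... | no _   | yes _ | ih = m≤n⇒m≤1+n ih
  ... | no _   | no _  | ih = ih

map-lookup-allFin : ∀ {A : Set} (xs : List A) → map (lookup xs) (allFin (length xs)) ≡ xs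
map-lookup-allFin xs = trans (map-tabulate id (lookup xs)) (tabulate-lookup xs)

Any-lookup : ∀ {A : Set} {P : A → Set} {n} {v : Vec A n} i → P (Vec.lookup v i) → Any P v
Any-lookup {v = _ ∷ _} zero    px = here px
Any-lookup {v = _ ∷ _} (suc i) px = there (Any-lookup i px)

module _ (Γ : LabelCover) where
  open LabelCover Γ

  covers-cong : ∀ {σU σU′ σV σV′} → σU ≗ σU′ → σV ≗ σV′ → ∀ {u} → Covers (σU , σV) u → Covers (σU′ , σV′) u
  covers-cong σU≗ σV≗ {u} cov v =
    Maybe.map (λ {Π} → subst₂ (λ x y → T (Π x y)) (σU≗ u) (σV≗ v)) (cov v)

  -- `labelings` lists functions only up to pointwise equality, so `σ` is first replaced by its
  -- listed copy `σ′`.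
  coveredCount≤maxCov : ∀ σ → coveredCount σ ≤ maxCov
  coveredCount≤maxCov σ@(σU , σV) = ≤-trans
    (subst (λ us → coveredCount σ ≤ length (filter (covers? σ′) us)) (map-id (allFin #U))
      (count-map-≤ (covers? σ) (covers? σ′) id
        (covers-cong (sym ∘ finToFun-funToFin σU) (sym ∘ finToFun-funToFin σV)) (allFin #U)))
    (Allˡ.lookup (xs≤max 0 (map coveredCount labelings))
      (∈-map⁺ coveredCount (∈-cartesianProductWith⁺ (λ i j → finToFun i , finToFun j)
        (∈-allFin (funToFin σU)) (∈-allFin (funToFin σV)))))
    where
    σ′ : Labeling
    σ′ = finToFun (funToFin σU) , finToFun (funToFin σV)

  maxCov≤#U : maxCov ≤ #U
  maxCov≤#U = max≤v⁺ z≤n (Allˡ.map⁺ (Allˡ.universal (λ σ →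
    ≤-trans (length-filter (covers? σ) (allFin #U)) (≤-reflexive (length-tabulate id))) labelings))

  -- The maximum is attained by a listed labeling or is the default value 0 of `max`.
  maxCov-preserves : ∀ {p} {P : ℕ → Set p} → P 0 → (∀ σ → P (coveredCount σ)) → P maxCov
  maxCov-preserves {P = P} p0 pσ with argmax-sel id 0 (map coveredCount labelings)
  ... | inj₁ eq = subst P (sym eq) p0
  ... | inj₂ max∈ with ∈-map⁻ coveredCount max∈
  ...   | σ , _ , eq = subst P (sym eq) (pσ σ)

-- A vertex of U is a k-tuple of clauses; its label selects a literal of each
-- of them, which is supposed to be true.  The i-th vertex of V is the i-th
-- block of g variables, and its label is an assignment to this block.
module Reduction {n : ℕ} (q g : ℕ) (n≤q*g : n ≤ q * g) where

  block : Fin n → Fin q × Fin g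
  block i = remQuot g (inject≤ i n≤q*g)

  agrees : Fin q → Vec Bool g → Literal n → Bool
  agrees v y (sign , i) =
    if does (v Fin.≟ proj₁ (block i)) then not (Vec.lookup y (proj₂ (block i)) xor sign) else true

  -- The accumulator `r` mirrors the `fold` by which the program computes this conjunction.
  consistent : ∀ {k} → Fin q → Vec Bool g → Bool → Vec (Clause n) k → Vec (Fin 3) k → Bool
  consistent v y r []      []      = r
  consistent v y r (c ∷ u) (j ∷ x) = consistent v y (agrees v y (Vec.lookup c j) ∧ r) u x

  consistent⁺ : ∀ {k v y r} (u : Vec (Clause n) k) x → T r →
                (∀ i → T (agrees v y (Vec.lookup (Vec.lookup u i) (Vec.lookup x i)))) →
                T (consistent v y r u x)
  consistent⁺ []      []      tr _  = tr
  consistent⁺ (c ∷ u) (j ∷ x) tr ag =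
    consistent⁺ u x (Equivalence.from T-∧ (ag zero , tr)) (ag ∘ suc)

  consistent⁻ : ∀ {k v y r} (u : Vec (Clause n) k) x → T (consistent v y r u x) →
                T r × (∀ i → T (agrees v y (Vec.lookup (Vec.lookup u i) (Vec.lookup x i))))
  consistent⁻ []      []      tr = tr , λ ()
  consistent⁻ (c ∷ u) (j ∷ x) t with consistent⁻ u x t
  ... | t∧ , ag with Equivalence.to T-∧ t∧
  ...   | tj , tr = tr , λ { zero → tj ; (suc i) → ag i }

  module _ .{{_ : NonZero q}} (cs : List (Clause n)) .{{_ : NonZero (length cs)}} (k : ℕ) where

    us : List (Vec (Clause n) k)
    us = tuples cs k

    xs : List (Vec (Fin 3) k)
    xs = tuples (allFin 3) k

    ys : List (Vec Bool g)
    ys = tuples (false ∷ true ∷ []) g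

    private
      nonZero-tuples : ∀ {A : Set} (zs : List A) k .{{_ : NonZero (length zs)}} → NonZero (length (tuples zs k))
      nonZero-tuples zs k = subst NonZero (sym (length-tuples zs k)) (m^n≢0 (length zs) k)

    labelCover : LabelCover
    labelCover = record
      { #U = length us
      ; #V = q
      ; #ΣU = length xs
      ; #ΣV = length ys
      ; U-nonempty = nonZero-tuples cs k
      ; ΣU-nonempty = nonZero-tuples (allFin 3) k
      ; ΣV-nonempty = nonZero-tuples (false ∷ true ∷ []) g
      ; constraint = λ u v → just λ x y → consistent v (lookup ys y) true (lookup us u) (lookup xs x)
      }

    open LabelCover labelCover using (Labeling; coveredCount; covers?; Covers; maxCov)

    satisfied : Assignment n → ℕ
    satisfied a = length (filter (satisfies? a) cs)

    private
      decode : Labeling → Assignment n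
      decode (σU , σV) i = Vec.lookup (lookup ys (σV (proj₁ (block i)))) (proj₂ (block i))

      -- The edge to the block that contains the variable of a selected literal checks that literal;
      -- the other edges ignore it.
      sound : ∀ σ {u} → Covers σ u → All (Satisfies (decode σ)) (lookup us u)
      sound σ@(σU , σV) {u} cov = All.lookup⁻ (λ i → Any-lookup (Vec.lookup x i) (true-literal i))
        where
        x = lookup xs (σU u)
        agreement : ∀ v i → T (agrees v (lookup ys (σV v)) (Vec.lookup (Vec.lookup (lookup us u) i) (Vec.lookup x i)))
        agreement v with cov v
        ... | Maybe.just t = proj₂ (consistent⁻ (lookup us u) x t)
        agrees⇒true : ∀ l → (∀ v → T (agrees v (lookup ys (σV v)) l)) → TrueLiteral (decode σ) l
        agrees⇒true (sign , i) ag with proj₁ (block i) Fin.≟ proj₁ (block i) | ag (proj₁ (block i))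
        ... | yes _  | t = t
        ... | no v≢v | _ = contradiction refl v≢v
        true-literal : ∀ i → TrueLiteral (decode σ) (Vec.lookup (Vec.lookup (lookup us u) i) (Vec.lookup x i))
        true-literal i = agrees⇒true _ (λ v → agreement v i)

      module Encode (a : Assignment n) where

        extended : Fin (q * g) → Bool
        extended z with toℕ z <? n
        ... | yes z<n = a (fromℕ< z<n)
        -- Places beyond the `n` variables, present if n < q · g, are filled arbitrarily.
        ... | no _    = false

        extended-inject≤ : ∀ i → extended (inject≤ i n≤q*g) ≡ a i
        extended-inject≤ i with toℕ (inject≤ i n≤q*g) <? n
        ... | yes z<n = cong a (trans (Fin.fromℕ<-cong _ _ (toℕ-inject≤ i n≤q*g) z<n (toℕ<n i)) (fromℕ<-toℕ i (toℕ<n i)))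
        ... | no z≮n  = contradiction (subst (_< n) (sym (toℕ-inject≤ i n≤q*g)) (toℕ<n i)) z≮n

        part : Fin q → Vec Bool g
        part v = Vec.tabulate (λ j → extended (combine v j))

        position : Clause n → Fin 3
        position c with satisfies? a c
        ... | yes s = Any.index s
        -- An arbitrary position: a tuple with an unsatisfied clause need not be covered.
        ... | no _  = zero

        position-true : ∀ {c} → Satisfies a c → TrueLiteral a (Vec.lookup c (position c))
        position-true {c} s with satisfies? a c
        ... | yes s′ = Any.lookup-index s′
        ... | no ¬s  = contradiction s ¬s

        agrees-part : ∀ v {l} → TrueLiteral a l → T (agrees v (part v) l)
        agrees-part v {sign , i} t with v Fin.≟ proj₁ (block i)
        ... | no _ = _
        ... | yes refl = subst (λ b → T (not (b xor sign))) (sym (begin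
          Vec.lookup (part v) (proj₂ (block i))  ≡⟨ Vec.lookup∘tabulate _ (proj₂ (block i)) ⟩
          extended (combine v (proj₂ (block i))) ≡⟨ cong extended (combine-remQuot {q} g (inject≤ i n≤q*g)) ⟩
          extended (inject≤ i n≤q*g)             ≡⟨ extended-inject≤ i ⟩
          a i                                    ∎)) t
          where open ≡-Reasoning

        part∈ys : ∀ v → part v ∈ ys
        part∈ys v = ∈-tuples (All.universal bool∈ (part v))
          where
          bool∈ : ∀ b → b ∈ false ∷ true ∷ []
          bool∈ false = Anyˡ.here refl
          bool∈ true  = Anyˡ.there (Anyˡ.here refl)

        positions∈xs : ∀ u → Vec.map position u ∈ xs
        positions∈xs u = ∈-tuples (All.universal ∈-allFin _)

        encode : Labeling
        encode = (λ u → Anyˡ.index (positions∈xs (lookup us u))) , (λ v → Anyˡ.index (part∈ys v))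

        complete : ∀ {u} → All (Satisfies a) (lookup us u) → Covers encode u
        complete {u} sat v = Maybe.just
          (subst₂ (λ x y → T (consistent v y true (lookup us u) x))
            (Anyˡ.lookup-index (positions∈xs (lookup us u))) (Anyˡ.lookup-index (part∈ys v))
            (consistent⁺ (lookup us u) _ _ λ i → agrees-part v
              (subst (TrueLiteral a ∘ Vec.lookup (Vec.lookup (lookup us u) i)) (sym (Vec.lookup-map i position (lookup us u)))
                (position-true (All.lookup⁺ sat i)))))

    satisfied^k≤maxCov : ∀ a → satisfied a ^ k ≤ maxCov
    satisfied^k≤maxCov a = begin
      satisfied a ^ k                                       ≡⟨ count-tuples (satisfies? a) cs k ⟨
      length (filter sat? us)                               ≡⟨ cong (length ∘ filter sat?) (map-lookup-allFin us) ⟨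
      length (filter sat? (map (lookup us) (allFin _)))     ≤⟨ count-map-≥ (covers? encode) sat? (lookup us) (λ {u} → complete {u}) (allFin _) ⟩
      coveredCount encode                                   ≤⟨ coveredCount≤maxCov labelCover encode ⟩
      maxCov                                                ∎
      where
      open ≤-Reasoning
      open Encode a
      sat? = All.all? (satisfies? a)

    maxCov≤satisfied^k : ∃[ a ] maxCov ≤ satisfied a ^ k
    maxCov≤satisfied^k = maxCov-preserves labelCover {P = λ m → ∃[ a ] m ≤ satisfied a ^ k} ((λ _ → false) , z≤n) (λ σ → decode σ , covered≤ σ)
      where
      open ≤-Reasoning
      covered≤ : ∀ σ → coveredCount σ ≤ satisfied (decode σ) ^ k
      covered≤ σ = begin
        coveredCount σ                                      ≤⟨ count-map-≤ (covers? σ) sat? (lookup us) (λ {u} → sound σ {u}) (allFin _) ⟩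
        length (filter sat? (map (lookup us) (allFin _)))   ≡⟨ cong (length ∘ filter sat?) (map-lookup-allFin us) ⟩
        length (filter sat? us)                             ≡⟨ count-tuples (satisfies? (decode σ)) cs k ⟩
        satisfied (decode σ) ^ k                            ∎
        where sat? = All.all? (satisfies? (decode σ))

-- The reduction as a program

trueᴱ : Expr
trueᴱ = cons nil nil

-- Trees that depend only on `q` and `k` may be part of the program text, since these are fixed
-- before the input is given.
quoteᴱ : Tree → Expr
quoteᴱ nil     = nil
quoteᴱ (t ∙ u) = cons (quoteᴱ t) (quoteᴱ u)

⟦quoteᴱ⟧ : ∀ t s → ⟦ quoteᴱ t ⟧ s ≡ t
⟦quoteᴱ⟧ nil     s = refl
⟦quoteᴱ⟧ (t ∙ u) s = cong₂ _∙_ (⟦quoteᴱ⟧ t s) (⟦quoteᴱ⟧ u s)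

head tail : Tree → Tree
head nil     = nil
head (t ∙ _) = t
tail nil     = nil
tail (_ ∙ t) = t

⟦hd⟧ : ∀ e s → ⟦ hd e ⟧ s ≡ head (⟦ e ⟧ s)
⟦hd⟧ e s with ⟦ e ⟧ s
... | nil   = refl
... | _ ∙ _ = refl

⟦tl⟧ : ∀ e s → ⟦ tl e ⟧ s ≡ tail (⟦ e ⟧ s)
⟦tl⟧ e s with ⟦ e ⟧ s
... | nil   = refl
... | _ ∙ _ = refl

drops nils : ℕ → Tree → Tree
drops zero    t = t
drops (suc i) t = drops i (tail t)
nils zero    t = t
nils (suc i) t = nils i (nil ∙ t)

-- Applied to a block assignment, this gives a list indexed by all variables: `g * v` blanks, then
-- block `v`; reading past the end gives `nil`, a blank as well. The program can thus look up a
-- variable without computing its block.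
pads : ℕ → ℕ → Tree → Tree
pads g zero    t = t
pads g (suc v) t = pads g v (nils g t)

encodeVec : ∀ {A : Set} {n} → (A → Tree) → Vec A n → Tree
encodeVec enc v = encodeList (Vec.toList (Vec.map enc v))

encodeFin : ∀ {n} → Fin n → Tree
encodeFin = encodeℕ ∘ toℕ

-- A nonempty tree also for `false`, to be distinguished from the `nil` that is
-- read outside of a list.
encodeBit : Bool → Tree
encodeBit b = encodeBool b ∙ nil

nils-suc : ∀ i t → nils (suc i) t ≡ nil ∙ nils i t
nils-suc zero    t = refl
nils-suc (suc i) t = nils-suc i (nil ∙ t)

drops-+ : ∀ i j t → drops (i + j) t ≡ drops j (drops i t)
drops-+ zero    j t = refl
drops-+ (suc i) j t = drops-+ i j (tail t)

drops-nil : ∀ i → drops i nil ≡ nil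
drops-nil zero    = refl
drops-nil (suc i) = drops-nil i

drops-nils : ∀ i t → drops i (nils i t) ≡ t
drops-nils zero    t = refl
drops-nils (suc i) t rewrite nils-suc i t = drops-nils i t

head-drops-nils : ∀ {i j} t → i < j → head (drops i (nils j t)) ≡ nil
head-drops-nils {zero}  {suc j} t _ rewrite nils-suc j t = refl
head-drops-nils {suc i} {suc j} t (s≤s i<j) rewrite nils-suc j t = head-drops-nils t i<j

pads-suc : ∀ g v t → pads g (suc v) t ≡ nils g (pads g v t)
pads-suc g zero    t = refl
pads-suc g (suc v) t = pads-suc g v (nils g t)

head-drops-encodeVec : ∀ {A : Set} {n} (enc : A → Tree) (v : Vec A n) i →
                       head (drops (toℕ i) (encodeVec enc v)) ≡ enc (Vec.lookup v i)
head-drops-encodeVec enc (x ∷ v) zero    = refl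
head-drops-encodeVec enc (x ∷ v) (suc i) = head-drops-encodeVec enc v i

drops-encodeVec : ∀ {A : Set} {n} (enc : A → Tree) (v : Vec A n) → drops n (encodeVec enc v) ≡ nil
drops-encodeVec enc []      = refl
drops-encodeVec enc (x ∷ v) = drops-encodeVec enc v

-- A place of an earlier block falls into the padding, one of a later block past the end of the
-- list.
head-drops-pads : ∀ {q g} (v v′ : Fin q) (y : Vec Bool g) j →
  head (drops (g * toℕ v′ + toℕ j) (pads g (toℕ v) (encodeVec encodeBit y))) ≡
  (if does (v Fin.≟ v′) then encodeBit (Vec.lookup y j) else nil)
head-drops-pads {g = g} zero zero y j rewrite *-zeroʳ g = head-drops-encodeVec encodeBit y j
head-drops-pads {g = g} zero (suc v′) y j
  rewrite *-suc g (toℕ v′) | +-assoc g (g * toℕ v′) (toℕ j)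
        | drops-+ g (g * toℕ v′ + toℕ j) (encodeVec encodeBit y)
        | drops-encodeVec encodeBit y | drops-nil (g * toℕ v′ + toℕ j) = refl
head-drops-pads {g = g} (suc v) zero y j
  rewrite *-zeroʳ g | pads-suc g (toℕ v) (encodeVec encodeBit y) =
  head-drops-nils (pads g (toℕ v) (encodeVec encodeBit y)) (toℕ<n j)
head-drops-pads {g = g} (suc v) (suc v′) y j
  rewrite *-suc g (toℕ v′) | +-assoc g (g * toℕ v′) (toℕ j)
        | pads-suc g (toℕ v) (encodeVec encodeBit y)
        | drops-+ g (g * toℕ v′ + toℕ j) (nils g (pads g (toℕ v) (encodeVec encodeBit y)))
        | drops-nils g (pads g (toℕ v) (encodeVec encodeBit y)) =
  head-drops-pads v v′ y j

encodeTable-lookup : ∀ {A : Set} (F : A → Tree) xs → encodeTable (F ∘ lookup xs) ≡ encodeList (map F xs)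
encodeTable-lookup F xs =
  cong encodeList (trans (sym (map-tabulate (lookup xs) F)) (cong (map F) (tabulate-lookup xs)))

encodeℕ-length : ∀ {A : Set} (xs : List A) → encodeList (map (λ _ → nil) xs) ≡ encodeℕ (length xs)
encodeℕ-length []       = refl
encodeℕ-length (x ∷ xs) = cong (nil ∙_) (encodeℕ-length xs)

dropᶜ : Expr → Expr → Code
dropᶜ e e′ = fold e e′ (ret (tl (var 1)))

lookupᶜ : Expr → Expr → Code
lookupᶜ e e′ = let′ (dropᶜ e e′) (ret (hd (var 0)))

-- The first `fold` accumulates its results in reverse; the second restores the order that the
-- encoding prescribes.
collectᶜ : Expr → Code → Code
collectᶜ e b = let′ (fold e nil b) (fold (var 0) nil (ret (cons (hd (var 0)) (var 1))))

mapᶜ : Expr → Code → Code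
mapᶜ e b = collectᶜ e (let′ b (ret (cons (var 0) (var 2))))

-- Meant as the body of an outer `fold` whose accumulator, the tuples built so far, is `var 3` here.
prependᶜ : Expr → Code
prependᶜ e =
  collectᶜ e (fold (var 3) (var 1) (ret (cons (cons (hd (var 2)) (hd (var 0))) (var 1))))

-- The second expression is evaluated inside the fold.
tuplesᶜ : Expr → Expr → Code
tuplesᶜ e e′ = fold e (cons nil nil) (prependᶜ e′)

module Correctness (X : ℕ) where
  open Evaluation X

  drop-⇓ : ∀ {ρ e e′ i t} → ⟦ e ⟧ (nth ρ) ≡ encodeℕ i → ⟦ e′ ⟧ (nth ρ) ≡ t → i ≤ X →
           ρ ⊢ dropᶜ e e′ ⇓ drops i t
  drop-⇓ {ρ} eq eq′ i≤X = fold eq eq′ (go _ _) i≤X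
    where
    go : ∀ i t → Loop ρ (ret (tl (var 1))) i (encodeℕ i) t (drops i t)
    go zero    t = done
    go (suc i) t = next (ret (⟦tl⟧ (var 1) (nth ((nil ∙ encodeℕ i) ∙ t ∙ ρ)))) (go i (tail t))

  lookup-⇓ : ∀ {ρ e e′ i t t′} → ⟦ e ⟧ (nth ρ) ≡ encodeℕ i → ⟦ e′ ⟧ (nth ρ) ≡ t → i ≤ X →
             head (drops i t) ≡ t′ → ρ ⊢ lookupᶜ e e′ ⇓ t′
  lookup-⇓ {ρ} {i = i} {t} eq eq′ i≤X eq″ =
    let′ (drop-⇓ eq eq′ i≤X) (ret (trans (⟦hd⟧ (var 0) (nth (drops i t ∙ ρ))) eq″))

  module _ {A B : Set} {encA : A → Tree} {encB : B → Tree} {h : A → List B} {ρ b}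
           (body : ∀ x r zs → (encA x ∙ r) ∙ encodeList zs ∙ ρ ⊢ b ⇓ encodeList (map encB (h x) ʳ++ zs)) where

    collect-loop : ∀ xs zs → Loop ρ b (length xs) (encodeList (map encA xs)) (encodeList zs)
                               (encodeList (map encB (concatMap h xs) ʳ++ zs))
    collect-loop []       zs = done
    collect-loop (x ∷ xs) zs = next (body x _ zs)
      (subst (Loop ρ b _ _ _)
        (cong encodeList (trans (sym (++-ʳ++ (map encB (h x)))) (cong (_ʳ++ zs) (sym (map-++ encB (h x) (concatMap h xs))))))
        (collect-loop xs (map encB (h x) ʳ++ zs)))

  reverse-loop : ∀ {ρ} ts zs → Loop ρ (ret (cons (hd (var 0)) (var 1))) (length ts)
                   (encodeList ts) (encodeList zs) (encodeList (ts ʳ++ zs))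
  reverse-loop []       zs = done
  reverse-loop (t ∷ ts) zs = next (ret refl) (reverse-loop ts (t ∷ zs))

  collect-⇓ : ∀ {A B : Set} {encA : A → Tree} {encB : B → Tree} {h : A → List B} {ρ e b} xs →
    ⟦ e ⟧ (nth ρ) ≡ encodeList (map encA xs) → length xs ≤ X → length (concatMap h xs) ≤ X →
    (∀ x r zs → (encA x ∙ r) ∙ encodeList zs ∙ ρ ⊢ b ⇓ encodeList (map encB (h x) ʳ++ zs)) →
    ρ ⊢ collectᶜ e b ⇓ encodeList (map encB (concatMap h xs))
  collect-⇓ {encB = encB} {h} xs eq ≤X ≤X′ body =
    let′ (fold eq refl (collect-loop body xs []) ≤X)
      (fold refl refl
        (subst (Loop _ (ret (cons (hd (var 0)) (var 1))) _ (encodeList (ts ʳ++ [])) nil) (cong encodeList (trans (ʳ++-ʳ++ ts) (++-identityʳ ts))) (reverse-loop (ts ʳ++ []) []))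
        (subst (_≤ X) (sym (trans (length-ʳ++ ts) (trans (+-identityʳ _) (length-map encB (concatMap h xs))))) ≤X′))
    where ts = map encB (concatMap h xs)

  map-⇓ : ∀ {A : Set} {encA : A → Tree} {F : A → Tree} {ρ e b} xs →
    ⟦ e ⟧ (nth ρ) ≡ encodeList (map encA xs) → length xs ≤ X →
    (∀ x r a → (encA x ∙ r) ∙ a ∙ ρ ⊢ b ⇓ F x) →
    ρ ⊢ mapᶜ e b ⇓ encodeList (map F xs)
  map-⇓ {F = F} {ρ} {e} {b} xs eq ≤X body =
    subst (λ ys → ρ ⊢ mapᶜ e b ⇓ encodeList (map F ys)) (concatMap-pure xs)
      (collect-⇓ {encB = F} {h = [_]} xs eq ≤X (subst (λ ys → length ys ≤ X) (sym (concatMap-pure xs)) ≤X)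
        (λ x r zs → let′ (body x r (encodeList zs)) (ret refl)))

  tuples-⇓ : ∀ {A : Set} {enc : A → Tree} {ρ e e′ k} cs →
    ⟦ e ⟧ (nth ρ) ≡ encodeℕ k → (∀ l a → ⟦ e′ ⟧ (nth (l ∙ a ∙ ρ)) ≡ encodeList (map enc cs)) →
    k ≤ X → length cs ≤ X → (∀ {j} → j ≤ k → length cs ^ j ≤ X) →
    ρ ⊢ tuplesᶜ e e′ ⇓ encodeList (map (encodeVec enc) (tuples cs k))
  tuples-⇓ {A} {enc} {ρ} {e′ = e′} {k} cs eq eq′ k≤X cs≤X cs^≤X =
    fold eq refl (subst (Loop ρ (prependᶜ e′) k (encodeℕ k) (E 0)) (cong E (+-identityʳ k)) (go k 0 (≤-reflexive (+-identityʳ k)))) k≤X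
    where
    E : ℕ → Tree
    E j = encodeList (map (encodeVec enc) (tuples cs j))
    prepend-loop : ∀ {ρ c r a j} (us : List (Vec A j)) zs →
      Loop ((enc c ∙ r) ∙ a ∙ ρ) (ret (cons (cons (hd (var 2)) (hd (var 0))) (var 1))) (length us)
        (encodeList (map (encodeVec enc) us)) (encodeList zs)
        (encodeList (map (encodeVec enc) (map (c ∷_) us) ʳ++ zs))
    prepend-loop []       zs = done
    prepend-loop (u ∷ us) zs = next (ret refl) (prepend-loop us (_ ∷ zs))
    tuples≤X : ∀ {j} → j ≤ k → length (tuples cs j) ≤ X
    tuples≤X {j} j≤k = subst (_≤ X) (sym (length-tuples cs j)) (cs^≤X j≤k)
    go : ∀ i j → i + j ≤ k → Loop ρ (prependᶜ e′) i (encodeℕ i) (E j) (E (i + j))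
    go zero    j _   = done
    go (suc i) j i+j≤k = next
      (collect-⇓ cs (eq′ _ _) cs≤X (tuples≤X (≤-trans (s≤s (m≤n+m j i)) i+j≤k))
        (λ c r zs → fold refl refl (prepend-loop (tuples cs j) zs) (tuples≤X (≤-trans (m≤n+m j (suc i)) i+j≤k))))
      (subst (λ m → Loop ρ (prependᶜ e′) i (encodeℕ i) (E (suc j)) (E m)) (+-suc i j)
        (go i (suc j) (subst (_≤ k) (sym (+-suc i j)) i+j≤k)))

-- The accumulator pairs the free places with the number of blocks. The blocks counted here have
-- `suc q′` places each, one of which is taken at once; their number is n / q rounded up, the wanted
-- length `g` of the actual blocks. This is division by counting.
placeᶜ : ℕ → Code
placeᶜ q′ =
  ifc (hd (var 1))
    (ret (cons (tl (hd (var 1))) (tl (var 1))))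
    (ret (cons (quoteᴱ (encodeℕ q′)) (cons nil (tl (var 1)))))

-- Counts through the variables, with a new block started whenever the number
-- of free places in the current block has dropped to 0.
blocksᶜ : ℕ → Code
blocksᶜ q′ = fold (hd (var 0)) (cons nil nil) (placeᶜ q′)

agreesᶜ : Code
agreesᶜ =
  ifc (var 0) (ifc (hd (var 0)) (ret (hd (var 1))) (ifc (hd (var 1)) (ret nil) (ret trueᴱ))) (ret trueᴱ)

-- The accumulator pairs the positions still to be read with the verdict so far; the padded block
-- assignment is `var 2`.
consistentᶜ : Code
consistentᶜ =
  let′ (lookupᶜ (hd (hd (var 1))) (hd (var 0)))
  (let′ (lookupᶜ (tl (var 0)) (var 3))
  (let′ agreesᶜ
  (ifc (var 0) (ret (cons (tl (hd (var 4))) (tl (var 4)))) (ret (cons (tl (hd (var 4))) nil)))))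

-- Each of the four maps around it adds two entries to the environment: the lists headed by `y`,
-- `x`, `v`, `u` are `var 0`, `var 2`, `var 4`, `var 6`, and `g` is the tail of `var 12`, hence of
-- `var 14` inside a `fold`.
entryᶜ : Code
entryᶜ =
  let′ (fold (hd (var 4)) (hd (var 0)) (fold (tl (var 14)) (var 1) (ret (cons nil (var 1)))))
  (let′ (fold (hd (var 7)) (cons (hd (var 3)) trueᴱ) consistentᶜ)
  (ret (tl (var 0))))

tableᶜ : Tree → Tree → Code
tableᶜ vs xs =
  mapᶜ (var 2) (mapᶜ (quoteᴱ vs)
    (let′ (mapᶜ (quoteᴱ xs) (mapᶜ (var 9) entryᶜ)) (ret (cons (var 0) nil))))

encodedBits : Tree
encodedBits = encodeList (map encodeBit (false ∷ true ∷ []))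

encodedGroups encodedPositions : ℕ → Tree
encodedGroups    q = encodeList (map encodeFin (allFin q))
encodedPositions k = encodeList (map (encodeVec encodeFin) (tuples (allFin 3) k))

reductionᶜ : ℕ → ℕ → Code
reductionᶜ q′ k =
  let′ (blocksᶜ q′)
  (let′ (tuplesᶜ (tl (var 0)) (quoteᴱ encodedBits))
  (let′ (tuplesᶜ (quoteᴱ (encodeℕ k)) (tl (var 4)))
  (let′ (mapᶜ (var 0) (ret nil))
  (let′ (mapᶜ (var 2) (ret nil))
  (let′ (tableᶜ (encodedGroups (suc q′)) (encodedPositions k))
  (ret (cons (var 2) (cons (quoteᴱ (encodeℕ (suc q′)))
    (cons (quoteᴱ (encodeℕ (length (tuples (allFin 3) k)))) (cons (var 1) (var 0)))))))))))

-- The equation balances accounts: every variable uses one place and every new block supplies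
-- `suc q′`. The derivation holds for all `X`, because the `X` used later depends on the `g`
-- computed here.
blocks-loop : ∀ {q′ ρ} n c g → c ≤ q′ → ∃[ c′ ] ∃[ g′ ]
  ( c′ ≤ q′ × n + c′ + g * suc q′ ≡ g′ * suc q′ + c
  × (∀ X → Evaluation.Loop X ρ (placeᶜ q′) n (encodeℕ n) (encodeℕ c ∙ encodeℕ g) (encodeℕ c′ ∙ encodeℕ g′)) )
blocks-loop zero c g c≤ = c , g , c≤ , +-comm c _ , λ _ → Evaluation.done
blocks-loop {q′} (suc n) zero g c≤ with blocks-loop n q′ (suc g) ≤-refl
... | c′ , g′ , c′≤ , eq , L =
  c′ , g′ , c′≤ ,
  +-cancelʳ-≡ q′ _ _ (trans (lemma n c′ g q′) (trans eq (cong (_+ q′) (sym (+-identityʳ (g′ * suc q′)))))) ,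
  λ X → let open Evaluation X in
    next (ifc false refl (ret (cong (_∙ _) (⟦quoteᴱ⟧ (encodeℕ q′) _)))) (L X)
  where
  lemma : ∀ n c g q′ → suc n + c + g * suc q′ + q′ ≡ n + c + suc g * suc q′
  lemma = solve-∀
blocks-loop {q′} (suc n) (suc c) g c≤ with blocks-loop n c g (≤-trans (n≤1+n c) c≤)
... | c′ , g′ , c′≤ , eq , L =
  c′ , g′ , c′≤ , trans (cong suc eq) (sym (+-suc (g′ * suc q′) c)) ,
  λ X → let open Evaluation X in next (ifc true refl (ret refl)) (L X)

-- g is n / q, rounded up.
blocks-⇓ : ∀ q′ (let q = suc q′) n {cs ρ} → ∃[ c ] ∃[ g ]
  ( n ≤ q * g × g * q ≤ n + q
  × (∀ {X} → n ≤ X → Evaluation._⊢_⇓_ X ((encodeℕ n ∙ cs) ∙ ρ) (blocksᶜ q′) (encodeℕ c ∙ encodeℕ g)) )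
blocks-⇓ q′ n with blocks-loop n 0 0 z≤n
... | c , g , c≤ , eq , L = c , g ,
  ≤-trans (m≤m+n n c) (≤-reflexive (trans n+c≡ (*-comm g (suc q′)))) ,
  ≤-trans (≤-reflexive (sym n+c≡)) (+-monoʳ-≤ n (≤-trans c≤ (n≤1+n q′))) ,
  λ {X} n≤X → Evaluation.fold refl refl (L X) n≤X
  where
  n+c≡ : n + c ≡ g * suc q′
  n+c≡ = trans (sym (+-identityʳ _)) (trans eq (+-identityʳ _))

record Fits (X n q k g m : ℕ) : Set where
  field
    3≤X : 3 ≤ X
    n≤X : n ≤ X
    q≤X : q ≤ X
    k≤X : k ≤ X
    g≤X : g ≤ X
    m≤X : m ≤ X
    2^≤X : ∀ {j} → j ≤ g → 2 ^ j ≤ X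
    3^≤X : 3 ^ k ≤ X
    m^≤X : ∀ {j} → j ≤ k → m ^ j ≤ X

module Table (X q′ : ℕ) {n g : ℕ} (n≤q*g : n ≤ suc q′ * g) where
  open Evaluation X
  open Correctness X

  private q = suc q′
  open Reduction q g n≤q*g

  encodeClause : Clause n → Tree
  encodeClause = encodeVec encodeLiteral

  module _ (cs : List (Clause n)) .{{_ : NonZero (length cs)}} (k : ℕ) (fits : Fits X n q k g (length cs)) where
    open Fits fits

    agrees-⇓ : ∀ v y sign i {ρ} →
      (if does (v Fin.≟ proj₁ (block i)) then encodeBit (Vec.lookup y (proj₂ (block i))) else nil)
        ∙ encodeLiteral (sign , i) ∙ ρ
      ⊢ agreesᶜ ⇓ encodeBool (agrees v y (sign , i))
    agrees-⇓ v y sign i with does (v Fin.≟ proj₁ (block i)) | Vec.lookup y (proj₂ (block i)) | sign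
    ... | false | _     | _     = ifc false refl (ret refl)
    ... | true  | true  | true  = ifc true refl (ifc true refl (ret refl))
    ... | true  | true  | false = ifc true refl (ifc true refl (ret refl))
    ... | true  | false | true  = ifc true refl (ifc false refl (ifc true refl (ret refl)))
    ... | true  | false | false = ifc true refl (ifc false refl (ifc false refl (ret refl)))

    cell : ∀ v y i →
      head (drops (toℕ i) (pads g (toℕ v) (encodeVec encodeBit y))) ≡
      (if does (v Fin.≟ proj₁ (block i)) then encodeBit (Vec.lookup y (proj₂ (block i))) else nil)
    cell v y i = trans
      (cong (λ l → head (drops l (pads g (toℕ v) (encodeVec encodeBit y))))
        (trans (sym (toℕ-inject≤ i n≤q*g))
          (trans (cong toℕ (sym (combine-remQuot {q} g _)))
            (toℕ-combine (proj₁ (block i)) (proj₂ (block i))))))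
      (head-drops-pads v (proj₁ (block i)) y (proj₂ (block i)))

    consistent-loop : ∀ {j v y ρ} (u : Vec (Clause n) j) x r →
      Loop (pads g (toℕ v) (encodeVec encodeBit y) ∙ ρ) consistentᶜ j
        (encodeVec encodeClause u) (encodeVec encodeFin x ∙ encodeBool r)
        (nil ∙ encodeBool (consistent v y r u x))
    consistent-loop []      []      r = done
    consistent-loop {v = v} {y} {ρ} (c ∷ u) (j ∷ x) r =
      next (let′ (lookup-⇓ refl refl (≤-trans (<⇒≤ (toℕ<n j)) 3≤X) (head-drops-encodeVec encodeLiteral c j))
           (let′ (lookup-⇓ refl refl (≤-trans (<⇒≤ (toℕ<n i)) n≤X) (cell v y i))
           (let′ (agrees-⇓ v y sign i)
           (and-⇓ (agrees v y (sign , i))))))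
        (consistent-loop u x (agrees v y (sign , i) ∧ r))
      where
      sign = proj₁ (Vec.lookup c j)
      i = proj₂ (Vec.lookup c j)
      and-⇓ : ∀ b {t t₁ t₂ t₃ t₄} →
        encodeBool b ∙ t₁ ∙ t₂ ∙ t₃ ∙ ((t ∙ encodeVec encodeFin x) ∙ encodeBool r) ∙ t₄ ∙ ρ
        ⊢ ifc (var 0) (ret (cons (tl (hd (var 4))) (tl (var 4)))) (ret (cons (tl (hd (var 4))) nil))
        ⇓ encodeVec encodeFin x ∙ encodeBool (b ∧ r)
      and-⇓ true  = ifc true refl (ret refl)
      and-⇓ false = ifc false refl (ret refl)

    nils-loop : ∀ {ρ} i t → Loop ρ (ret (cons nil (var 1))) i (encodeℕ i) t (nils i t)
    nils-loop zero    t = done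
    nils-loop (suc i) t = next (ret refl) (nils-loop i (nil ∙ t))

    pads-loop : ∀ {ρ e} → (∀ l a → ⟦ e ⟧ (nth (l ∙ a ∙ ρ)) ≡ encodeℕ g) → ∀ v t →
      Loop ρ (fold e (var 1) (ret (cons nil (var 1)))) v (encodeℕ v) t (pads g v t)
    pads-loop eq zero    t = done
    pads-loop eq (suc v) t = next (fold (eq _ _) refl (nils-loop g t) g≤X) (pads-loop eq v (nils g t))

    entry-⇓ : ∀ (u : Vec (Clause n) k) v x y {r₁ r₂ r₃ r₄ a₁ a₂ a₃ a₄ b₁ b₂ b₃ b₄ c ρ} →
      (encodeVec encodeBit y ∙ r₄) ∙ a₄ ∙ (encodeVec encodeFin x ∙ r₃) ∙ a₃ ∙
      (encodeFin v ∙ r₂) ∙ a₂ ∙ (encodeVec encodeClause u ∙ r₁) ∙ a₁ ∙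
      b₁ ∙ b₂ ∙ b₃ ∙ b₄ ∙ (c ∙ encodeℕ g) ∙ ρ
      ⊢ entryᶜ ⇓ encodeBool (consistent v y true u x)
    entry-⇓ u v x y =
      let′ (fold refl refl (pads-loop (λ _ _ → refl) (toℕ v) _) (≤-trans (<⇒≤ (toℕ<n v)) q≤X))
      (let′ (fold refl refl (consistent-loop u x true) k≤X)
      (ret refl))

    Γ : LabelCover
    Γ = labelCover cs k

    length-xs : length (tuples (allFin 3) k) ≡ 3 ^ k
    length-xs = length-tuples (allFin 3) k

    table-⇓ : ∀ {b₁ b₂ c ρ} →
      b₁ ∙ b₂ ∙ encodeList (map (encodeVec encodeClause) (us cs k)) ∙
      encodeList (map (encodeVec encodeBit) (ys cs k)) ∙ (c ∙ encodeℕ g) ∙ ρ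
      ⊢ tableᶜ (encodedGroups q) (encodedPositions k)
      ⇓ encodeTable (λ u → encodeTable (λ v → encodeConstraint (LabelCover.constraint Γ u v)))
    table-⇓ =
      by (sym (encodeTable-lookup E₁ (us cs k))) (map-⇓ {F = E₁} (us cs k) refl us≤X λ u _ _ →
      by (cong encodeList (map-tabulate id (E₂ u))) (map-⇓ {F = E₂ u} (allFin q) (⟦quoteᴱ⟧ (encodedGroups q) _) vs≤X λ v _ _ →
      let′
        (by (sym (encodeTable-lookup (E₃ u v) (xs cs k))) (map-⇓ {F = E₃ u v} (xs cs k) (⟦quoteᴱ⟧ (encodedPositions k) _) xs≤X λ x _ _ →
         by (sym (encodeTable-lookup _ (ys cs k))) (map-⇓ {F = λ y → encodeBool (consistent v y true u x)} (ys cs k) refl ys≤X λ y _ _ →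
         entry-⇓ u v x y)))
        (ret refl)))
      where
      by : ∀ {ρ c t t′} → t ≡ t′ → ρ ⊢ c ⇓ t → ρ ⊢ c ⇓ t′
      by refl D = D
      E₃ : Vec (Clause n) k → Fin q → Vec (Fin 3) k → Tree
      E₃ u v x = encodeTable (λ y → encodeBool (consistent v (lookup (ys cs k) y) true u x))
      E₂ : Vec (Clause n) k → Fin q → Tree
      E₂ u v = encodeTable (E₃ u v ∘ lookup (xs cs k)) ∙ nil
      E₁ : Vec (Clause n) k → Tree
      E₁ u = encodeTable (E₂ u)
      vs≤X : length (allFin q) ≤ X
      vs≤X = subst (_≤ X) (sym (length-tabulate {n = q} id)) q≤X
      us≤X : length (us cs k) ≤ X
      us≤X = subst (_≤ X) (sym (length-tuples cs k)) (m^≤X ≤-refl)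
      xs≤X : length (xs cs k) ≤ X
      xs≤X = subst (_≤ X) (sym length-xs) 3^≤X
      ys≤X : length (ys cs k) ≤ X
      ys≤X = subst (_≤ X) (sym (length-tuples (false ∷ true ∷ []) g)) (2^≤X ≤-refl)

    reduction-⇓ : ∀ {c} →
      (encodeℕ n ∙ encodeList (map encodeClause cs)) ∙ nil ⊢ blocksᶜ q′ ⇓ c ∙ encodeℕ g →
      (encodeℕ n ∙ encodeList (map encodeClause cs)) ∙ nil ⊢ reductionᶜ q′ k ⇓ encodeLabelCover Γ
    reduction-⇓ D =
      let′ D
      (let′ (tuples-⇓ (false ∷ true ∷ []) refl (λ _ _ → refl) g≤X (≤-trans (n≤1+n 2) 3≤X) 2^≤X)
      (let′ (tuples-⇓ cs (⟦quoteᴱ⟧ (encodeℕ k) _) (λ _ _ → refl) k≤X m≤X m^≤X)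
      (let′ (map-⇓ (us cs k) refl (subst (_≤ X) (sym (length-tuples cs k)) (m^≤X ≤-refl)) (λ _ _ _ → ret refl))
      (let′ (map-⇓ (ys cs k) refl (subst (_≤ X) (sym (length-tuples (false ∷ true ∷ []) g)) (2^≤X ≤-refl)) (λ _ _ _ → ret refl))
      (let′ table-⇓
      (ret (cong₂ _∙_ (encodeℕ-length (us cs k))
        (cong₂ _∙_ (⟦quoteᴱ⟧ (encodeℕ q) _)
          (cong₂ _∙_ (⟦quoteᴱ⟧ (encodeℕ (length (xs cs k))) _)
            (cong₂ _∙_ (encodeℕ-length (ys cs k)) refl))))))))))

-- Arithmetic and real numbers

^-distribʳ-* : ∀ k m n → (m * n) ^ k ≡ m ^ k * n ^ k
^-distribʳ-* zero    m n = refl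
^-distribʳ-* (suc k) m n rewrite ^-distribʳ-* k m n = lemma m n (m ^ k) (n ^ k)
  where lemma : ∀ m n x y → m * n * (x * y) ≡ m * x * (n * y)
        lemma = solve-∀

n<2^n : ∀ n → n < 2 ^ n
n<2^n zero    = s≤s z≤n
n<2^n (suc n) = begin-strict
  suc n             ≡⟨ +-comm 1 n ⟩
  n + 1             <⟨ +-mono-<-≤ (n<2^n n) (m^n>0 2 n) ⟩
  2 ^ n + 2 ^ n     ≡⟨ cong (λ x → 2 ^ n + x) (sym (+-identityʳ _)) ⟩
  2 ^ suc n         ∎
  where open ≤-Reasoning

m^[1+j]-≤ : ∀ m j .{{_ : NonZero m}} → m ^ j ≤ m ^ suc j
m^[1+j]-≤ m j = m≤n*m (m ^ j) m

-- With J = j + 1, a nonzero divisor, suc n is at most (n / J + 1) · J, and (n / J + 1)^J is at most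
-- 2^(n / J · J).
polynomial≤exponential : ∀ j n → suc n ^ j ≤ suc j ^ suc j * 2 ^ n
polynomial≤exponential j n = begin
  suc n ^ j                    ≤⟨ m^[1+j]-≤ (suc n) j ⟩
  suc n ^ J                    ≤⟨ ^-monoˡ-≤ J n<[1+n/J]*J ⟩
  (suc (n / J) * J) ^ J        ≡⟨ ^-distribʳ-* J (suc (n / J)) J ⟩
  suc (n / J) ^ J * J ^ J      ≤⟨ *-monoˡ-≤ (J ^ J) (^-monoˡ-≤ J (n<2^n (n / J))) ⟩
  (2 ^ (n / J)) ^ J * J ^ J    ≡⟨ cong (_* (J ^ J)) (^-*-assoc 2 (n / J) J) ⟩
  2 ^ (n / J * J) * J ^ J      ≤⟨ *-monoˡ-≤ (J ^ J) (^-monoʳ-≤ 2 (m/n*n≤m n J)) ⟩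
  2 ^ n * J ^ J                ≡⟨ *-comm (2 ^ n) (J ^ J) ⟩
  J ^ J * 2 ^ n                ∎
  where
  open ≤-Reasoning
  J = suc j
  n<[1+n/J]*J : n < suc (n / J) * J
  n<[1+n/J]*J = subst (_< suc (n / J) * J) (sym (m≡m%n+[m/n]*n n J)) (+-monoˡ-< (n / J * J) (m%n<n n J))

-- One factor 2ⁿ pays for the power of 2ᵍ, since g · e ≤ g · q ≤ n + q, and the other for the
-- polynomial.
absorb : ∀ A c f {q} → ∃[ A′ ] ∀ {n g e} → e ≤ q → g * q ≤ n + q →
         A * ((2 ^ g) ^ e * (c * suc n) ^ f) ≤ A′ * 2 ^ (n + n)
absorb A c f {q} = A * 2 ^ q * c ^ f * suc f ^ suc f , λ {n} {g} {e} e≤q gq≤n+q → begin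
  A * ((2 ^ g) ^ e * (c * suc n) ^ f)
    ≡⟨ cong (λ x → A * ((2 ^ g) ^ e * x)) (^-distribʳ-* f c (suc n)) ⟩
  A * ((2 ^ g) ^ e * (c ^ f * suc n ^ f))
    ≤⟨ *-monoʳ-≤ A (*-mono-≤ (2^ge≤ n g e e≤q gq≤n+q) (*-monoʳ-≤ (c ^ f) (polynomial≤exponential f n))) ⟩
  A * (2 ^ n * 2 ^ q * (c ^ f * (suc f ^ suc f * 2 ^ n)))
    ≡⟨ lemma A (2 ^ n) (2 ^ q) (c ^ f) (suc f ^ suc f) ⟩
  A * 2 ^ q * c ^ f * suc f ^ suc f * (2 ^ n * 2 ^ n)
    ≡⟨ cong ((A * 2 ^ q * c ^ f * suc f ^ suc f) *_) (^-distribˡ-+-* 2 n n) ⟨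
  A * 2 ^ q * c ^ f * suc f ^ suc f * 2 ^ (n + n) ∎
  where
  open ≤-Reasoning
  lemma : ∀ a x y z w → a * (x * y * (z * (w * x))) ≡ a * y * z * w * (x * x)
  lemma = solve-∀
  2^ge≤ : ∀ n g e → e ≤ q → g * q ≤ n + q → (2 ^ g) ^ e ≤ 2 ^ n * 2 ^ q
  2^ge≤ n g e e≤q gq≤n+q = begin
    (2 ^ g) ^ e   ≡⟨ ^-*-assoc 2 g e ⟩
    2 ^ (g * e)   ≤⟨ ^-monoʳ-≤ 2 (≤-trans (*-monoʳ-≤ g e≤q) gq≤n+q) ⟩
    2 ^ (n + q)   ≡⟨ ^-distribˡ-+-* 2 n q ⟩
    2 ^ n * 2 ^ q ∎

^-cancelˡ-≤ : ∀ k .{{_ : NonZero k}} {m n} → m ^ k ≤ n ^ k → m ≤ n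
^-cancelˡ-≤ k m^k≤n^k = ≮⇒≥ λ n<m → <⇒≱ (^-monoˡ-< k n<m) m^k≤n^k

+-^-≤ : ∀ D m n → (m + n) ^ D ≤ 2 ^ D * (m ^ D + n ^ D)
+-^-≤ D m n with ≤-total m n
... | inj₁ m≤n = begin
  (m + n) ^ D             ≤⟨ ^-monoˡ-≤ D (+-monoˡ-≤ n m≤n) ⟩
  (n + n) ^ D             ≡⟨ cong (λ x → (n + x) ^ D) (+-identityʳ n) ⟨
  (2 * n) ^ D             ≡⟨ ^-distribʳ-* D 2 n ⟩
  2 ^ D * n ^ D           ≤⟨ *-monoʳ-≤ (2 ^ D) (m≤n+m (n ^ D) (m ^ D)) ⟩
  2 ^ D * (m ^ D + n ^ D) ∎
  where open ≤-Reasoning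
... | inj₂ n≤m = begin
  (m + n) ^ D             ≤⟨ ^-monoˡ-≤ D (+-monoʳ-≤ m n≤m) ⟩
  (m + m) ^ D             ≡⟨ cong (λ x → (m + x) ^ D) (+-identityʳ m) ⟨
  (2 * m) ^ D             ≡⟨ ^-distribʳ-* D 2 m ⟩
  2 ^ D * m ^ D           ≤⟨ *-monoʳ-≤ (2 ^ D) (m≤m+n (m ^ D) (n ^ D)) ⟩
  2 ^ D * (m ^ D + n ^ D) ∎
  where open ≤-Reasoning

square-root : ∀ b A n {s} → s ^ (b * 2) ≤ A * 2 ^ (n + n) → s ^ b ≤ A * 2 ^ n
square-root b A n {s} s^2b≤ = ^-cancelˡ-≤ 2 (begin
  (s ^ b) ^ 2                   ≡⟨ ^-*-assoc s b 2 ⟩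
  s ^ (b * 2)                   ≤⟨ s^2b≤ ⟩
  A * 2 ^ (n + n)               ≤⟨ *-monoˡ-≤ (2 ^ (n + n)) (m≤m^2 A) ⟩
  A ^ 2 * 2 ^ (n + n)           ≡⟨ cong ((A ^ 2) *_) (trans (^-distribˡ-+-* 2 n n) (cong ((2 ^ n) *_) (sym (*-identityʳ (2 ^ n))))) ⟩
  A ^ 2 * (2 ^ n) ^ 2           ≡⟨ ^-distribʳ-* 2 A (2 ^ n) ⟨
  (A * 2 ^ n) ^ 2               ∎)
  where
  open ≤-Reasoning
  m≤m^2 : ∀ m → m ≤ m ^ 2
  m≤m^2 zero      = z≤n
  m≤m^2 m@(suc _) = m≤m*n m (m * 1) {{m*n≢0 m 1}}

-- This is 1 + n/d ≤ (1 + 1/d)ⁿ with denominators cleared; it is used for n = d.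
bernoulli : ∀ d n → d ^ n * (d + n) ≤ d * suc d ^ n
bernoulli d zero    = ≤-reflexive (lemma d)
  where lemma : ∀ d → 1 * (d + 0) ≡ d * 1
        lemma = solve-∀
bernoulli d (suc n) = begin
  d * d ^ n * (d + suc n)                   ≤⟨ m≤m+n _ (d ^ n * n) ⟩
  d * d ^ n * (d + suc n) + d ^ n * n       ≡⟨ lemma d n (d ^ n) ⟩
  suc d * (d ^ n * (d + n))                 ≤⟨ *-monoʳ-≤ (suc d) (bernoulli d n) ⟩
  suc d * (d * suc d ^ n)                   ≡⟨ lemma′ (suc d) d (suc d ^ n) ⟩
  d * (suc d * suc d ^ n)                   ∎
  where
  open ≤-Reasoning
  lemma : ∀ d n x → d * x * (d + suc n) + x * n ≡ suc d * (x * (d + n))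
  lemma = solve-∀
  lemma′ : ∀ a b c → a * (b * c) ≡ b * (a * c)
  lemma′ = solve-∀

2*d^d≤[1+d]^d : ∀ d .{{_ : NonZero d}} → 2 * d ^ d ≤ suc d ^ d
2*d^d≤[1+d]^d d = *-cancelˡ-≤ d (begin
  d * (2 * d ^ d)   ≡⟨ lemma d (d ^ d) ⟩
  d ^ d * (d + d)   ≤⟨ bernoulli d d ⟩
  d * suc d ^ d     ∎)
  where
  open ≤-Reasoning
  lemma : ∀ d x → d * (2 * x) ≡ x * (d + d)
  lemma = solve-∀

-- From e ≥ 1 and s ≤ m the gap gives s/m < d/(d + 1). The d-th power of d/(d + 1) is at most 1/2,
-- so d · l repetitions reach 2^-l.
amplify : ∀ {d e l s m} .{{_ : NonZero d}} .{{_ : NonZero e}} .{{_ : NonZero l}} →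
          e * m + d * s < d * m → 2 ^ l * s ^ (d * l) < m ^ (d * l)
amplify {d} {e} {l} {s} {m} gap = *-cancelˡ-< (d ^ k) _ _ (begin-strict
  d ^ k * (2 ^ l * s ^ k)        ≡⟨ lemma (d ^ k) (2 ^ l) (s ^ k) ⟩
  2 ^ l * d ^ k * s ^ k          ≤⟨ *-monoˡ-≤ (s ^ k) 2^l*d^k≤ ⟩
  suc d ^ k * s ^ k              ≡⟨ ^-distribʳ-* k (suc d) s ⟨
  (suc d * s) ^ k                <⟨ ^-monoˡ-< k {{m*n≢0 d l}} [1+d]s<dm ⟩
  (d * m) ^ k                    ≡⟨ ^-distribʳ-* k d m ⟩
  d ^ k * m ^ k                  ∎)
  where
  open ≤-Reasoning
  k = d * l
  lemma : ∀ a b c → a * (b * c) ≡ b * a * c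
  lemma = solve-∀
  s≤m : s ≤ m
  s≤m = *-cancelˡ-≤ d (≤-trans (m≤n+m (d * s) (e * m)) (<⇒≤ gap))
  [1+d]s<dm : suc d * s < d * m
  [1+d]s<dm = ≤-<-trans (+-monoˡ-≤ (d * s) (≤-trans s≤m (m≤n*m m e))) gap
  2^l*d^k≤ : 2 ^ l * d ^ k ≤ suc d ^ k
  2^l*d^k≤ = begin
    2 ^ l * d ^ (d * l)   ≡⟨ cong ((2 ^ l) *_) (^-*-assoc d d l) ⟨
    2 ^ l * (d ^ d) ^ l   ≡⟨ ^-distribʳ-* l 2 (d ^ d) ⟨
    (2 * d ^ d) ^ l       ≤⟨ ^-monoˡ-≤ l (2*d^d≤[1+d]^d d) ⟩
    (suc d ^ d) ^ l       ≡⟨ ^-*-assoc (suc d) d l ⟩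
    suc d ^ (d * l)       ∎

-- Rational gaps, and powers of 1/2 around a real number

toℚᵘ-fromℕ : ∀ n → toℚᵘ (fromℕ n) ℚᵘ.≃ mkℚᵘ (+ n) 0
toℚᵘ-fromℕ n = ℚ.toℚᵘ-fromℚᵘ (mkℚᵘ (+ n) 0)

gap⇒ℕ : ∀ ε {s m} → 0ℚ ℚ.< ε → fromℕ s ℚ.< (1ℚ ℚ.- ε) ℚ.* fromℕ m →
        ∣ ↥ ε ∣ * m + ↧ₙ ε * s < ↧ₙ ε * m
gap⇒ℕ (mkℚ (+ 0) _ _) (ℚ.*<* (ℤ.+<+ ())) _
gap⇒ℕ (mkℚ -[1+ _ ] _ _) (ℚ.*<* ()) _
gap⇒ℕ ε@(mkℚ (+ suc e) d-1 _) {s} {m} _ s<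
  with ℚᵘ.<-respˡ-≃ (toℚᵘ-fromℕ s) (ℚᵘ.<-respʳ-≃ rhs≃ (ℚ.toℚᵘ-mono-< s<))
  where
  rhs≃ : toℚᵘ ((1ℚ ℚ.- ε) ℚ.* fromℕ m) ℚᵘ.≃ (toℚᵘ 1ℚ ℚᵘ.- toℚᵘ ε) ℚᵘ.* mkℚᵘ (+ m) 0
  rhs≃ = ℚᵘ.≃-trans (ℚ.toℚᵘ-homo-* (1ℚ ℚ.- ε) (fromℕ m))
    (ℚᵘ.*-cong (ℚ.toℚᵘ-homo-+ 1ℚ (ℚ.- ε)) (toℚᵘ-fromℕ m))
... | ℚᵘ.*<* lt = ℤ.drop‿+<+ (subst₂ ℤ._<_ lhs≡ rhs≡ (ℤ.+-monoʳ-< (E ℤ.* M) lt))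
  where
  E = + suc e
  D = + suc d-1
  S = + s
  M = + m
  lhs≡ : E ℤ.* M ℤ.+ S ℤ.* + suc (pred (suc (d-1 + 0) * 1)) ≡ + (suc e * m + suc d-1 * s)
  lhs≡ = trans (cong (λ x → E ℤ.* M ℤ.+ S ℤ.* + x) (trans (*-identityʳ _) (+-identityʳ (suc d-1))))
    (trans (cong (λ x → E ℤ.* M ℤ.+ x) (ℤ.*-comm S D))
      (cong₂ ℤ._+_ (sym (ℤ.pos-* (suc e) m)) (sym (ℤ.pos-* (suc d-1) s))))
  rhs≡ : E ℤ.* M ℤ.+ ((ℤ.1ℤ ℤ.* D ℤ.+ ℤ.- E ℤ.* ℤ.1ℤ) ℤ.* M) ℤ.* ℤ.1ℤ ≡ + (suc d-1 * m)
  rhs≡ = trans (lemma E D M) (sym (ℤ.pos-* (suc d-1) m))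
    where
    lemma : ∀ E D M → E ℤ.* M ℤ.+ ((ℤ.1ℤ ℤ.* D ℤ.+ ℤ.- E ℤ.* ℤ.1ℤ) ℤ.* M) ℤ.* ℤ.1ℤ ≡ D ℤ.* M
    lemma = ℤ.solve-∀

2^-_ : ℕ → ℚ
2^- l = mkℚ (+ 1) (pred (2 ^ l)) (1-coprimeTo _)

↧ₙ-2^- : ∀ l → ↧ₙ (2^- l) ≡ 2 ^ l
↧ₙ-2^- l = suc-pred (2 ^ l) {{m^n≢0 2 l}}

numerator≢0 : ∀ {r} → 0ℚ ℚ.< r → NonZero ∣ ↥ r ∣
numerator≢0 {mkℚ (+ suc n) _ _} _ = nonZero
numerator≢0 {mkℚ (+ 0) _ _} (ℚ.*<* (ℤ.+<+ ()))
numerator≢0 {mkℚ -[1+ n ] _ _} (ℚ.*<* ())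

positive-numerator : ∀ {r} → 0ℚ ℚ.< r → ↥ r ≡ + ∣ ↥ r ∣
positive-numerator {mkℚ (+ n) _ _}    _ = refl
positive-numerator {mkℚ -[1+ n ] _ _} (ℚ.*<* ())

≤2^-⇒ : ∀ {r l} → 0ℚ ℚ.< r → r ℚ.≤ 2^- l → ∣ ↥ r ∣ * 2 ^ l ≤ ↧ₙ r
≤2^-⇒ {r} {l} 0<r (ℚ.*≤* le) = ℤ.drop‿+≤+ (subst₂ ℤ._≤_
  (trans (cong₂ ℤ._*_ (positive-numerator 0<r) (cong +_ (↧ₙ-2^- l))) (sym (ℤ.pos-* ∣ ↥ r ∣ (2 ^ l))))
  (ℤ.*-identityˡ (+ ↧ₙ r)) le)

2^-<2^- : ∀ l → 2^- (suc l) ℚ.< 2^- l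
2^-<2^- l = ℚ.*<* (subst₂ ℤ._<_ (sym (ℤ.*-identityˡ _)) (sym (ℤ.*-identityˡ _))
  (ℤ.+<+ (subst₂ _<_ (sym (↧ₙ-2^- l)) (sym (↧ₙ-2^- (suc l))) (^-monoʳ-< 2 ≤-refl (n<1+n l)))))

<2^-* : ∀ {l c U} → 2 ^ l * c < U → fromℕ c ℚ.< 2^- l ℚ.* fromℕ U
<2^-* {l} {c} {U} lt = ℚ.toℚᵘ-cancel-< (ℚᵘ.<-respˡ-≃ (ℚᵘ.≃-sym (toℚᵘ-fromℕ c))
  (ℚᵘ.<-respʳ-≃ (ℚᵘ.≃-sym (ℚᵘ.≃-trans (ℚ.toℚᵘ-homo-* (2^- l) (fromℕ U)) (ℚᵘ.*-congˡ {toℚᵘ (2^- l)} (toℚᵘ-fromℕ U))))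
    (ℚᵘ.*<* (subst₂ ℤ._<_ lhs≡ (sym rhs≡) (ℤ.+<+ lt)))))
  where
  lhs≡ : + (2 ^ l * c) ≡ + c ℤ.* + suc (pred (↧ₙ (2^- l) * 1))
  lhs≡ = trans (cong +_ (trans (*-comm (2 ^ l) c) (cong (c *_) (trans (sym (↧ₙ-2^- l)) (sym (*-identityʳ _)))))) (ℤ.pos-* c _)
  rhs≡ : ℤ.1ℤ ℤ.* + U ℤ.* ℤ.1ℤ ≡ + U
  rhs≡ = trans (ℤ.*-identityʳ _) (ℤ.*-identityˡ _)

module _ (γ : ℝ) where
  open ℝ γ using (lower-rounded; upper-rounded; disjoint; located)

  lower-downward : ∀ {p r} → p ℚ.< r → lower γ r → lower γ p
  lower-downward p<r lr = Equivalence.from (lower-rounded _) (_ , p<r , lr)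

  upper⇒≤ : ∀ {p r} → upper γ p → lower γ r → r ℚ.≤ p
  upper⇒≤ up lr = ℚ.≮⇒≥ λ p<r → disjoint _ (lower-downward p<r lr , up)

  private
    Scale : ℕ → Set
    Scale l = lower γ (2^- suc (suc l)) × (∀ r → lower γ r → r ℚ.≤ 2^- l)

    -- Comparing γ with a power of 1/2 is undecidable, but locatedness between 2^-(N+2) and 2^-(N+1)
    -- either certifies 2^-(N+2) < γ, while γ ≤ 2^-N is already known, or lets the search go on with
    -- γ ≤ 2^-(N+1). The overlap costs the factor 4.
    search : AtMostOneᴿ γ → ∀ N → (∃[ l ] Scale l) ⊎ (∀ r → lower γ r → r ℚ.≤ 2^- N)
    search γ≤1 zero = inj₂ λ r lr → ℚ.≮⇒≥ λ 1<r → γ≤1 (lower-downward 1<r lr)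
    search γ≤1 (suc N) with search γ≤1 N
    ... | inj₁ found = inj₁ found
    ... | inj₂ γ≤2^-N with located (2^-<2^- (suc N))
    ...   | inj₁ low = inj₁ (N , low , γ≤2^-N)
    ...   | inj₂ up  = inj₂ λ r → upper⇒≤ up

  scale : Positiveᴿ γ → AtMostOneᴿ γ →
          ∃[ l ] (lower γ (2^- suc (suc l)) × (∀ r → 0ℚ ℚ.< r → lower γ r → ∣ ↥ r ∣ * 2 ^ suc (suc l) ≤ 4 * ↧ₙ r))
  scale 0<γ γ≤1 with Equivalence.to (lower-rounded 0ℚ) 0<γ
  ... | r , 0<r , lr with search γ≤1 (↧ₙ r)
  -- The search ends by N = ↧ₙ r, as a positive r is at least 1 / ↧ₙ r, hence above 2^-N.
  ...   | inj₂ γ≤ = contradiction (≤2^-⇒ {l = ↧ₙ r} 0<r (γ≤ r lr))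
            (<⇒≱ (<-≤-trans (n<2^n (↧ₙ r)) (m≤n*m (2 ^ ↧ₙ r) ∣ ↥ r ∣ {{numerator≢0 0<r}})))
  ...   | inj₁ (l , low , γ≤) = l , low , λ r 0<r lr → begin
    ∣ ↥ r ∣ * 2 ^ suc (suc l)  ≡⟨ lemma ∣ ↥ r ∣ (2 ^ l) ⟩
    4 * (∣ ↥ r ∣ * 2 ^ l)      ≤⟨ *-monoʳ-≤ 4 (≤2^-⇒ {l = l} 0<r (γ≤ r lr)) ⟩
    4 * ↧ₙ r                   ∎
    where
    open ≤-Reasoning
    lemma : ∀ a x → a * (2 * (2 * x)) ≡ 4 * (a * x)
    lemma = solve-∀

-- For the alphabet size 3ᵏ with k = d · l: as 3 ≤ 2², it is at most (2^l)^(2d), whence the exponent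
-- 2d of 1/γ; the 4 is the slack in locating γ.
3^-≤ : ∀ d l {x y} → x * 2 ^ l ≤ 4 * y → 3 ^ (d * l) * x ^ (2 * d) ≤ 4 ^ (2 * d) * y ^ (2 * d)
3^-≤ d l {x} {y} le = begin
  3 ^ (d * l) * x ^ (2 * d)         ≤⟨ *-monoˡ-≤ (x ^ (2 * d)) (^-monoˡ-≤ (d * l) (n≤1+n 3)) ⟩
  (2 ^ 2) ^ (d * l) * x ^ (2 * d)   ≡⟨ cong (_* (x ^ (2 * d))) (trans (^-*-assoc 2 2 (d * l)) (trans (cong (2 ^_) (lemma d l)) (sym (^-*-assoc 2 l (2 * d))))) ⟩
  (2 ^ l) ^ (2 * d) * x ^ (2 * d)   ≡⟨ *-comm ((2 ^ l) ^ (2 * d)) (x ^ (2 * d)) ⟩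
  x ^ (2 * d) * (2 ^ l) ^ (2 * d)   ≡⟨ ^-distribʳ-* (2 * d) x (2 ^ l) ⟨
  (x * 2 ^ l) ^ (2 * d)             ≤⟨ ^-monoˡ-≤ (2 * d) le ⟩
  (4 * y) ^ (2 * d)                 ≡⟨ ^-distribʳ-* (2 * d) 4 y ⟩
  4 ^ (2 * d) * y ^ (2 * d)         ∎
  where
  open ≤-Reasoning
  lemma : ∀ d l → 2 * (d * l) ≡ l * (2 * d)
  lemma = solve-∀

-- Composition with an algorithm for label cover

module After {p p′ : Program} {x y : Tree} {T s′}
             (s′≗ : s′ ≗ only y) (r : start p′ x ⟶⟨ T ⟩ (p ∷ [] , s′)) where

  halts-after : ∀ {t} → HaltsWithin p y t → HaltsWithin p′ x (T + t)
  halts-after h ω = trans (cong proj₁ (run-⟶ r ω))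
    (trans (proj₁ (run-cong (Vec.drop T ω) (refl , s′≗))) (h (Vec.drop T ω)))

  answers-after : ∀ {t b} → AnswersWHP p y t b → AnswersWHP p′ x (T + t) b
  answers-after {t} {b} h = begin
    2 * 2 ^ (T + t)          ≡⟨ cong (2 *_) (^-distribˡ-+-* 2 T t) ⟩
    2 * (2 ^ T * 2 ^ t)      ≡⟨ lemma 2 (2 ^ T) (2 ^ t) ⟩
    2 ^ T * (2 * 2 ^ t)      ≤⟨ *-monoʳ-≤ (2 ^ T) h ⟩
    2 ^ T * (3 * count)      ≡⟨ lemma (2 ^ T) 3 count ⟩
    3 * (2 ^ T * count)      ≡⟨ cong (3 *_) (countCoins-drop T _) ⟨
    3 * countCoins (T + t) (λ ω → not (output (run (Vec.drop T ω) (start p y)) xor b))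
                             ≡⟨ cong (3 *_) (countCoins-cong (T + t) λ ω → cong (λ o → not (o xor b)) (same-output ω)) ⟨
    3 * countCoins (T + t) (λ ω → not (output (run ω (start p′ x)) xor b)) ∎
    where
    open ≤-Reasoning hiding (start)
    count = countCoins t (λ ω → not (output (run ω (start p y)) xor b))
    lemma : ∀ a b c → a * (b * c) ≡ b * (a * c)
    lemma = solve-∀
    same-output : ∀ ω → output (run ω (start p′ x)) ≡ output (run (Vec.drop T ω) (start p y))
    same-output ω = trans (cong output (run-⟶ r ω)) (output-cong (run-cong (Vec.drop T ω) (refl , s′≗)))

-- Four nested maps over `u`, `v`, `x`, `y` produce the constraint tables, and each entry needs two
-- more nested folds.
reductionDepth : ℕ
reductionDepth = 6

-- Bounds the lengths of all lists in the reduction, for m clauses in n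
-- variables with m ≤ B · n.
module Size (B q′ k n g : ℕ) where

  q scaled X : ℕ
  q = suc q′
  scaled = (3 + q + k + B) * suc n
  -- With `suc k`, `X` is at least `scaled` for every `k`, including 0.
  X = 2 ^ g * scaled ^ suc k

  instance
    scaled≢0 : NonZero scaled
    scaled≢0 = m*n≢0 (3 + q + k + B) (suc n)
    2^g≢0 : NonZero (2 ^ g)
    2^g≢0 = m^n≢0 2 g
    X≢0 : NonZero X
    X≢0 = m*n≢0 (2 ^ g) (scaled ^ suc k) {{2^g≢0}} {{m^n≢0 scaled (suc k)}}

  ≤scaled : ∀ {a} → a ≤ 3 + q + k + B → a ≤ scaled
  ≤scaled a≤ = ≤-trans a≤ (m≤m*n (3 + q + k + B) (suc n))

  3≤ : 3 ≤ 3 + q + k + B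
  3≤ = m≤m+n 3 _

  q≤ : q ≤ 3 + q + k + B
  q≤ = ≤-trans (m≤n+m q 3) (≤-trans (m≤m+n (3 + q) k) (m≤m+n (3 + q + k) B))

  k≤ : k ≤ 3 + q + k + B
  k≤ = ≤-trans (m≤n+m k (3 + q)) (m≤m+n (3 + q + k) B)

  n≤scaled : n ≤ scaled
  n≤scaled = ≤-trans (n≤1+n n) (m≤n*m (suc n) (3 + q + k + B))

  ^-≤X : ∀ {a j} → a ≤ scaled → j ≤ suc k → a ^ j ≤ X
  ^-≤X {a} {j} a≤ j≤ = begin
    a ^ j           ≤⟨ ^-monoˡ-≤ j a≤ ⟩
    scaled ^ j      ≤⟨ ^-monoʳ-≤ scaled j≤ ⟩
    scaled ^ suc k  ≤⟨ m≤n*m (scaled ^ suc k) (2 ^ g) ⟩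
    X               ∎
    where open ≤-Reasoning

  ≤X : ∀ {a} → a ≤ scaled → a ≤ X
  ≤X {a} a≤ = subst (_≤ X) (*-identityʳ a) (^-≤X {a} {1} a≤ (s≤s z≤n))

  2^≤X : ∀ {j} → j ≤ g → 2 ^ j ≤ X
  2^≤X j≤g = ≤-trans (^-monoʳ-≤ 2 j≤g) (m≤m*n (2 ^ g) (scaled ^ suc k) {{m^n≢0 scaled (suc k)}})

  module _ {m} (m≤B*n : m ≤ B * n) where

    m≤scaled : m ≤ scaled
    m≤scaled = ≤-trans m≤B*n (*-mono-≤ (m≤n+m B (3 + q + k)) (n≤1+n n))

    fits : Fits X n q k g m
    fits = record
      { 3≤X = ≤X (≤scaled 3≤)
      ; n≤X = ≤X n≤scaled
      ; q≤X = ≤X (≤scaled q≤)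
      ; k≤X = ≤X (≤scaled k≤)
      ; g≤X = ≤-trans (<⇒≤ (n<2^n g)) (2^≤X ≤-refl)
      ; m≤X = ≤X m≤scaled
      ; 2^≤X = 2^≤X
      ; 3^≤X = ^-≤X (≤scaled 3≤) (n≤1+n k)
      ; m^≤X = λ j≤k → ^-≤X m≤scaled (m≤n⇒m≤1+n j≤k)
      }

    totalSize≤ : 3 ^ k * 2 ^ g * m ^ k * q ≤ 2 ^ g * scaled ^ (k + (k + 1))
    totalSize≤ = begin
      3 ^ k * 2 ^ g * m ^ k * q
        ≤⟨ *-mono-≤ (*-mono-≤ (*-monoˡ-≤ (2 ^ g) (^-monoˡ-≤ k (≤scaled 3≤))) (^-monoˡ-≤ k m≤scaled)) (≤scaled q≤) ⟩
      scaled ^ k * 2 ^ g * scaled ^ k * scaled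
        ≡⟨ lemma (scaled ^ k) (2 ^ g) scaled ⟩
      2 ^ g * (scaled ^ k * (scaled ^ k * (scaled * 1)))
        ≡⟨ cong (λ z → 2 ^ g * (scaled ^ k * z)) (^-distribˡ-+-* scaled k 1) ⟨
      2 ^ g * (scaled ^ k * scaled ^ (k + 1))
        ≡⟨ cong (2 ^ g *_) (^-distribˡ-+-* scaled k (k + 1)) ⟨
      2 ^ g * scaled ^ (k + (k + 1)) ∎
      where
      open ≤-Reasoning
      lemma : ∀ a b c → a * b * a * c ≡ b * (a * (a * (c * 1)))
      lemma = solve-∀

abstract
  -- T is the time of the reduction and t that of the algorithm for label cover;
  -- the factors (c · suc n) ^ f are polynomial in n, and 2ᵍ ≈ 2^(n/q).
  time-bound : ∀ b c f₁ f₂ e q W C .{{_ : NonZero b}} → e * (b * 2) ≤ q →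
    ∃[ A ] ∀ {n g T t} → g * q ≤ n + q →
      T ≤ W * (2 ^ g * (c * suc n) ^ f₁) ^ e →
      t ^ (b * 2) ≤ C ^ (b * 2) * (2 ^ g * (c * suc n) ^ f₂) ^ q →
      (T + t) ^ b ≤ A * 2 ^ n
  time-bound b c f₁ f₂ e q W C eD≤q
    with absorb (W ^ (b * 2)) c (f₁ * (e * (b * 2))) {q} | absorb (C ^ (b * 2)) c (f₂ * q) {q}
  ... | A₁ , absorb₁ | A₂ , absorb₂ =
    2 ^ D * (A₁ + A₂) , λ {n} {g} {T} {t} gq≤ T≤ t≤ → square-root b (2 ^ D * (A₁ + A₂)) n (begin
      (T + t) ^ D                    ≤⟨ +-^-≤ D T t ⟩
      2 ^ D * (T ^ D + t ^ D)        ≤⟨ *-monoʳ-≤ (2 ^ D) (+-mono-≤ (T^D≤ n g T gq≤ T≤) (t^D≤ n g t gq≤ t≤)) ⟩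
      2 ^ D * (A₁ * 2 ^ (n + n) + A₂ * 2 ^ (n + n)) ≡⟨ lemma (2 ^ D) A₁ A₂ (2 ^ (n + n)) ⟩
      2 ^ D * (A₁ + A₂) * 2 ^ (n + n) ∎)
    where
    open ≤-Reasoning
    D : ℕ
    D = b * 2
    power : ∀ x y f e → (x * y ^ f) ^ e ≡ x ^ e * y ^ (f * e)
    power x y f e = trans (^-distribʳ-* e x (y ^ f)) (cong (x ^ e *_) (^-*-assoc y f e))
    lemma : ∀ a b c d → a * (b * d + c * d) ≡ a * (b + c) * d
    lemma = solve-∀
    T^D≤ : ∀ n g T → g * q ≤ n + q → T ≤ W * (2 ^ g * (c * suc n) ^ f₁) ^ e → T ^ D ≤ A₁ * 2 ^ (n + n)
    T^D≤ n g T gq≤ T≤ = begin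
      T ^ D                                             ≤⟨ ^-monoˡ-≤ D T≤ ⟩
      (W * (2 ^ g * (c * suc n) ^ f₁) ^ e) ^ D          ≡⟨ ^-distribʳ-* D W _ ⟩
      W ^ D * ((2 ^ g * (c * suc n) ^ f₁) ^ e) ^ D      ≡⟨ cong (W ^ D *_) (trans (^-*-assoc _ e D) (power (2 ^ g) (c * suc n) f₁ (e * D))) ⟩
      W ^ D * ((2 ^ g) ^ (e * D) * (c * suc n) ^ (f₁ * (e * D)))
                                                        ≤⟨ absorb₁ {n} {g} eD≤q gq≤ ⟩
      A₁ * 2 ^ (n + n)                                  ∎
    t^D≤ : ∀ n g t → g * q ≤ n + q → t ^ D ≤ C ^ D * (2 ^ g * (c * suc n) ^ f₂) ^ q → t ^ D ≤ A₂ * 2 ^ (n + n)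
    t^D≤ n g t gq≤ t≤ = begin
      t ^ D                                             ≤⟨ t≤ ⟩
      C ^ D * (2 ^ g * (c * suc n) ^ f₂) ^ q            ≡⟨ cong (C ^ D *_) (power (2 ^ g) (c * suc n) f₂ q) ⟩
      C ^ D * ((2 ^ g) ^ q * (c * suc n) ^ (f₂ * q))    ≤⟨ absorb₂ {n} {g} ≤-refl gq≤ ⟩
      A₂ * 2 ^ (n + n)                                  ∎

-- The formula without clauses has no label cover instance.
reduce-to : Program → ℕ → ℕ → Program
reduce-to p q′ k = branch (tl (var 0))
  -- The input becomes the only entry of the environment, and the result is taken off it at the end.
  -- Only variable 0 is ever assigned, so `p` finds the initial store it expects.
  ((0 ≔ cons (var 0) nil) ⨾ compile (reductionᶜ q′ k) ⨾ (0 ≔ hd (var 0)) ⨾ p)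
  (0 ≔ trueᴱ)

reduce-to-steps : ∀ {X} .{{_ : NonZero X}} {p q′ k n c cs t} →
  Evaluation._⊢_⇓_ X ((encodeℕ n ∙ c ∙ cs) ∙ nil) (reductionᶜ q′ k) t →
  ∃[ T ] (T ≤ (weight (reductionᶜ q′ k) + 6) * X ^ reductionDepth ×
    (reduce-to p q′ k ∷ [] , encodeℕ n ∙ c ∙ cs) ⟹⟨ T ⟩ (p ∷ [] , t))
reduce-to-steps {X} {q′ = q′} {k} D with Compilation.compile-correct X D
... | T , T≤ , steps = _ ,
  (begin
    3 + suc (T + 2)                       ≡⟨ lemma T ⟩
    T + 6                                 ≤⟨ +-mono-≤ T≤ (m≤m*n 6 (X ^ 6) {{m^n≢0 X 6}}) ⟩
    W * X ^ 6 + 6 * X ^ 6                 ≡⟨ *-distribʳ-+ (X ^ 6) W 6 ⟨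
    (W + 6) * X ^ 6                       ∎) ,
  (branch-step refl ▷ unfold ▷ assign _ ▷ unfold ▷ steps ▷ unfold ▷ assign _)
  where
  open ≤-Reasoning
  W = weight (reductionᶜ q′ k)
  lemma : ∀ T → 3 + suc (T + 2) ≡ T + 6
  lemma = solve-∀

-- The choice of parameters and the contradiction to Gap-ETH

module _ {δ ε : ℚ} (B : ℕ) (0<δ : 0ℚ ℚ.< δ) (0<ε : 0ℚ ℚ.< ε) where

  private
    b d : ℕ
    b = ↧ₙ δ
    d = ↧ₙ ε

  -- Half of 1/b, where 1/b ≤ δ because the numerator of δ is positive; the other half absorbs
  -- polynomial factors.
  δ′ : ℚ
  δ′ = mkℚ (+ 1) (pred (b * 2)) (1-coprimeTo _)

  LabelCoverAlgorithm : ℝ → ℕ → Set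
  LabelCoverAlgorithm γ q = DistinguishableIn
    (GapMaxCov γ (λ Γ → LabelCover.#V Γ ≡ q × LabelCover.#ΣU Γ ≤ 4 ^ (2 * d) ·[1/ γ ]^ (2 * d)))
    (λ C Γ t → t ≤ C · LabelCover.totalSize Γ ^[ δ′ · q ])

  module Simulation (q′ : ℕ) (6D≤q : reductionDepth * (b * 2) ≤ suc q′) (γ : ℝ) (l : ℕ)
    (lower-2^-L : lower γ (2^- suc (suc l)))
    (r≤ : ∀ r → 0ℚ ℚ.< r → lower γ r → ∣ ↥ r ∣ * 2 ^ suc (suc l) ≤ 4 * ↧ₙ r)
    (algorithm : LabelCoverAlgorithm γ (suc q′)) where

    p : Program
    p = proj₁ algorithm

    C : ℕ
    C = proj₁ (proj₂ algorithm)

    q L k A : ℕ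
    q = suc q′
    L = suc (suc l)
    -- By `amplify`, tuples of this length push the unsatisfiable case below 2^-L, which is less
    -- than γ.
    k = d * L

    timeBound = time-bound b (3 + q + k + B) (suc k) (k + (k + 1)) reductionDepth q (weight (reductionᶜ q′ k) + 6) C 6D≤q
    A = proj₁ timeBound

    bounded : ∀ {n g T t} → g * q ≤ n + q →
      T ≤ (weight (reductionᶜ q′ k) + 6) * Size.X B q′ k n g ^ reductionDepth →
      t ^ (b * 2) ≤ C ^ (b * 2) * (2 ^ g * Size.scaled B q′ k n g ^ (k + (k + 1))) ^ q →
      (T + t) ≤ (2 + A) · 2 ^[ δ · n ]
    bounded {n} {g} {T} {t} gq≤ T≤ t≤ = begin
      (T + t) ^ b                    ≤⟨ proj₂ timeBound {n} {g} {T} {t} gq≤ T≤ t≤ ⟩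
      -- The 2 in `2 + A` makes the constant nonzero, hence at most its `b`-th power, and also
      -- covers the two steps spent on a formula without clauses.
      A * 2 ^ n                      ≤⟨ *-mono-≤ (≤-trans (m≤n+m A 2) (m≤m^b (2 + A))) (^-monoʳ-≤ 2 (m≤n*m n ∣ ↥ δ ∣ {{numerator≢0 0<δ}})) ⟩
      (2 + A) ^ b * 2 ^ (∣ ↥ δ ∣ * n) ∎
      where
      open ≤-Reasoning
      m≤m^b : ∀ m .{{_ : NonZero m}} → m ≤ m ^ b
      m≤m^b m = subst (_≤ m ^ b) (^-identityʳ m) (^-monoʳ-≤ m {1} {b} (s≤s z≤n))

    Decided : Formula → Set
    Decided φ = ∃[ t ]
      ( t ≤ (2 + A) · 2 ^[ δ · Formula.vars φ ]
      × HaltsWithin (reduce-to p q′ k) (encodeFormula φ) t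
      × (PromiseProblem.Yes (Gap3SAT ε B) φ → AnswersWHP (reduce-to p q′ k) (encodeFormula φ) t true)
      × (PromiseProblem.No (Gap3SAT ε B) φ → AnswersWHP (reduce-to p q′ k) (encodeFormula φ) t false) )

    module Instance {n g} (n≤q*g : n ≤ q * g) (c₀ : Clause n) (cs₀ : List (Clause n)) where
      open Reduction q g n≤q*g

      cs : List (Clause n)
      cs = c₀ ∷ cs₀

      φ : Formula
      φ = record { vars = n ; clauses = cs }

      Γ : LabelCover
      Γ = labelCover cs k

      open LabelCover Γ using (#U; #ΣU; maxCov; totalSize)

      ΣU≤ : #ΣU ≤ 4 ^ (2 * d) ·[1/ γ ]^ (2 * d)
      ΣU≤ r 0<r lr = subst (λ N → N * ∣ ↥ r ∣ ^ (2 * d) ≤ 4 ^ (2 * d) * ↧ₙ r ^ (2 * d))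
        (sym (length-tuples (allFin 3) k)) (3^-≤ d L {∣ ↥ r ∣} {↧ₙ r} (r≤ r 0<r lr))

      #U≡ : #U ≡ length cs ^ k
      #U≡ = length-tuples cs k

      size≤⇒ : length cs ≤ B * n → ∀ {t} → t ≤ C · totalSize ^[ δ′ · q ] →
               t ^ (b * 2) ≤ C ^ (b * 2) * (2 ^ g * Size.scaled B q′ k n g ^ (k + (k + 1))) ^ q
      size≤⇒ m≤ {t} t≤ = begin
        t ^ (b * 2)                                ≤⟨ t≤ ⟩
        C ^ (b * 2) * totalSize ^ (1 * q)          ≡⟨ cong₂ (λ N e → C ^ (b * 2) * N ^ e) totalSize≡ (*-identityˡ q) ⟩
        C ^ (b * 2) * (3 ^ k * 2 ^ g * length cs ^ k * q) ^ q
                                                   ≤⟨ *-monoʳ-≤ (C ^ (b * 2)) (^-monoˡ-≤ q (Size.totalSize≤ B q′ k n g m≤)) ⟩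
        C ^ (b * 2) * (2 ^ g * Size.scaled B q′ k n g ^ (k + (k + 1))) ^ q ∎
        where
        open ≤-Reasoning
        totalSize≡ : totalSize ≡ 3 ^ k * 2 ^ g * length cs ^ k * q
        totalSize≡ = cong (_* q) (cong₂ _*_ (cong₂ _*_ (length-tuples (allFin 3) k)
          (length-tuples (false ∷ true ∷ []) g)) #U≡)

      complete : PromiseProblem.Yes (Gap3SAT ε B) φ → maxCov ≡ #U
      complete (a , all-satisfied) = ≤-antisym (maxCov≤#U Γ)
        (subst (_≤ maxCov) (trans (cong (_^ k) all-satisfied) (sym #U≡)) (satisfied^k≤maxCov cs k a))

      sound : PromiseProblem.No (Gap3SAT ε B) φ → maxCov < γ ·ᴿ #U
      sound few-satisfied = 2^- L , lower-2^-L , <2^-* {L} (begin-strict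
        2 ^ L * maxCov                     ≤⟨ *-monoʳ-≤ (2 ^ L) (proj₂ (maxCov≤satisfied^k cs k)) ⟩
        2 ^ L * satisfiedCount φ a ^ k     <⟨ amplify {d} {∣ ↥ ε ∣} {L} {satisfiedCount φ a} {length cs} {{_}} {{numerator≢0 0<ε}}
                                                (gap⇒ℕ ε {satisfiedCount φ a} {length cs} 0<ε (few-satisfied a)) ⟩
        length cs ^ k                      ≡⟨ #U≡ ⟨
        #U                                 ∎)
        where
        open ≤-Reasoning
        a = proj₁ (maxCov≤satisfied^k cs k)

      decide-with : ∀ {T s′} → length cs ≤ B * n → g * q ≤ n + q →
        T ≤ (weight (reductionᶜ q′ k) + 6) * Size.X B q′ k n g ^ reductionDepth →
        s′ ≗ only (encodeLabelCover Γ) →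
        start (reduce-to p q′ k) (encodeFormula φ) ⟶⟨ T ⟩ (p ∷ [] , s′) → Decided φ
      decide-with {T} {s′} m≤ g*q≤ T≤ s′≗ steps =
        let t , t≤ , halts , onYes , onNo = proj₂ (proj₂ algorithm) Γ (refl , ΣU≤)
            open After {p} {reduce-to p q′ k} {encodeFormula φ} {encodeLabelCover Γ} {T} {s′} s′≗ steps
        in T + t ,
           bounded {n} {g} {T} {t} g*q≤ T≤ (size≤⇒ m≤ {t} t≤) ,
           halts-after {t} halts ,
           (λ satisfiable → answers-after {t} {true} (onYes (complete satisfiable))) ,
           (λ far → answers-after {t} {false} (onNo (sound far)))

      decide-blocks : ∀ {t} → length cs ≤ B * n → g * q ≤ n + q →
        (∀ {X} → n ≤ X → Evaluation._⊢_⇓_ X (encodeFormula φ ∙ nil) (blocksᶜ q′) (t ∙ encodeℕ g)) →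
        Decided φ
      decide-blocks m≤ g*q≤ blocks =
        let open Size B q′ k n g using (X; X≢0)
            fits = Size.fits B q′ k n g m≤
            T , T≤ , steps = reduce-to-steps {X} {{X≢0}} {p} {q′} {k}
              (Table.reduction-⇓ X q′ n≤q*g cs k fits (blocks (Fits.n≤X fits)))
            s′ , s′≗ , steps′ = steps {only (encodeFormula φ)} (λ _ → refl)
        in decide-with m≤ g*q≤ T≤ s′≗ steps′

    decide : ∀ φ → Formula.size φ ≤ B * Formula.vars φ → Decided φ
    -- The branch and one assignment. Answering true is right, as the No case would require 0 < 0.
    decide record { vars = n ; clauses = [] } _ = 2 ,
      ≤-trans (^-monoˡ-≤ b (m≤m+n 2 A)) (m≤m*n ((2 + A) ^ b) (2 ^ (∣ ↥ δ ∣ * n)) {{m^n≢0 2 (∣ ↥ δ ∣ * n)}}) ,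
      (λ { (_ ∷ _ ∷ []) → refl }) ,
      (λ _ → m≤m+n 8 4) ,
      (λ far → contradiction (gap⇒ℕ ε {0} {0} 0<ε (far (λ _ → false)))
        (≤⇒≯ (m≤n+m (d * 0) (∣ ↥ ε ∣ * 0))))
    decide record { vars = n ; clauses = c ∷ cs } m≤ =
      let _ , _ , n≤q*g , g*q≤ , blocks = blocks-⇓ q′ n
      in Instance.decide-blocks n≤q*g c cs m≤ g*q≤ blocks

  distinguish-3SAT : ∀ q′ → reductionDepth * (b * 2) ≤ suc q′ → ∀ γ → Positiveᴿ γ → AtMostOneᴿ γ →
    LabelCoverAlgorithm γ (suc q′) → DistinguishableIn (Gap3SAT ε B) (λ C φ t → t ≤ C · 2 ^[ δ · Formula.vars φ ])
  distinguish-3SAT q′ 6D≤q γ 0<γ γ≤1 algorithm =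
    let l , lower-2^-L , r≤ = scale γ 0<γ γ≤1
        open Simulation q′ 6D≤q γ l lower-2^-L r≤ algorithm
    in reduce-to p q′ k , 2 + A , decide

theorem4p3 : GapETH →
    ∃[ δ ] ∃[ ρ ] ∃[ a ] ∃[ c ]
    ( 0ℚ ℚ.< δ × 0 < ρ ×
    (∀ (q : ℕ) → ρ ≤ q → ∀ (γ : ℝ) → Positiveᴿ γ → AtMostOneᴿ γ →
    ¬ DistinguishableIn
    (GapMaxCov γ (λ Γ → LabelCover.#V Γ ≡ q))
    (λ C Γ t → t ≤ C · LabelCover.totalSize Γ ^[ δ · q ])
    ×
    ¬ DistinguishableIn
    (GapMaxCov γ (λ Γ → LabelCover.#V Γ ≡ q × LabelCover.#ΣU Γ ≤ a ·[1/ γ ]^ c))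
    (λ C Γ t → t ≤ C · LabelCover.totalSize Γ ^[ δ · q ])) )
theorem4p3 (δ , ε , B , 0<δ , 0<ε , hard) =
  -- For q ≥ 6 · 2b the block length n/q makes (2ᵍ)^6 at most 2^(n/(2b)) up to a constant.
  δ′ B 0<δ 0<ε , reductionDepth * (↧ₙ δ * 2) , 4 ^ (2 * ↧ₙ ε) , 2 * ↧ₙ ε ,
  ℚ.positive⁻¹ _ , s≤s z≤n ,
  λ { (suc q′) ρ≤q γ 0<γ γ≤1 →
      -- An algorithm for all instances also solves those with a small alphabet.
      (λ (p , C , solves) → hard (distinguish-3SAT B 0<δ 0<ε q′ ρ≤q γ 0<γ γ≤1
        (p , C , λ Γ (V≡q , _) → solves Γ V≡q))) ,
      (λ D → hard (distinguish-3SAT B 0<δ 0<ε q′ ρ≤q γ 0<γ γ≤1 D)) }
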